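{- Let $$\overline{\mathrm S}(z,q)=\sum_{n=1}^\infty\frac{q^n(q^{2n+2};q^2)_\infty}{(zq^n;q)_\infty(z^{ -1}q^n;q)_\infty}.$$ Then, in $\mathbb{Z}[z,z^{ -1}][[q]]$, $$(1+z)(z;q)_\infty(z^{ -1};q)_\infty(q;q)_\infty\,\overline{\mathrm S}(z,q)=\sum_{n=0}^\infty\ \sum_{m=-\lfloor n/2\rfloor}^{\lfloor n/2\rfloor}(-1)^{m+n}(1-z^{n-2|m|+1})(1-z^{n-2|m|})\,z^{2|m|-n}\,q^{\frac12(n^2-2m^2)+\frac12n}.$$
   Context: Notation: $(a;q)_\infty=\prod_{k\ge 0}(1-aq^k)$, and $(a;q^2)_\infty=\prod_{k\ge0}(1-aq^{2k})$. $\lfloor x\rfloor$ is the integer part of $x$. $\overline{\mathrm S}(z,q)$ is the generating function of the spt-crank for overpartitions. -}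

module Defs where

open import Algebra.Bundles.Raw using (RawRing)
import Algebra.Definitions.RawSemiring as RawSemiringDefinitions
open import Data.Bool.Base using (if_then_else_)
open import Data.Fin.Base using (toℕ)
open import Data.Integer.Base as ℤ using (ℤ; +_; -[1+_]; ∣_∣)
import Data.Integer.Properties as ℤ
open import Data.List.Base using (List; []; _∷_; _++_; map; cartesianProductWith)
open import Data.Nat.Base as ℕ using (ℕ; zero; suc; _∸_; _/_)
import Data.Nat.Properties as ℕ
open import Data.Product.Base using (_×_; _,_)
open import Level using (0ℓ)
open import Relation.Binary.PropositionalEquality.Core using (_≡_)
open import Relation.Nullary.Decidable.Core using (does)

-- ℤ[z, z⁻¹].  A list of pairs (e , c) stands for the sum of the c z^e.
-- Exponents may repeat and coefficients may vanish, so equality is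
-- equality of all coefficients.

Laurent : Set
Laurent = List (ℤ × ℤ)

coeffᶻ : Laurent → ℤ → ℤ
coeffᶻ []            i = ℤ.0ℤ
coeffᶻ ((e , c) ∷ p) i = (if does (e ℤ.≟ i) then c else ℤ.0ℤ) ℤ.+ coeffᶻ p i

laurent : RawRing 0ℓ 0ℓ
laurent = record
  { Carrier = Laurent
  ; _≈_     = λ p r → ∀ i → coeffᶻ p i ≡ coeffᶻ r i
  ; _+_     = _++_
  ; _*_     = cartesianProductWith (λ (e , c) (e′ , c′) → e ℤ.+ e′ , c ℤ.* c′)
  ; -_      = map (λ (e , c) → e , ℤ.- c)
  ; 0#      = []
  ; 1#      = (ℤ.0ℤ , ℤ.1ℤ) ∷ []
  }

-- R[[q]].  A series is its sequence of coefficients.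

module PowerSeries {c ℓ} (R : RawRing c ℓ) where

  private
    module R where
      open RawRing R public
      open RawSemiringDefinitions rawSemiring public using (sum)

  monomial : R.Carrier → ℕ → ℕ → R.Carrier
  monomial a k n = if does (k ℕ.≟ n) then a else R.0#

  powerSeries : RawRing c ℓ
  powerSeries = record
    { Carrier = ℕ → R.Carrier
    ; _≈_     = λ f g → ∀ n → f n R.≈ g n
    ; _+_     = λ f g n → f n R.+ g n
    ; _*_     = λ f g n → R.sum {suc n} λ i → f (toℕ i) R.* g (n ∸ toℕ i)
    ; -_      = λ f n → R.- f n
    ; 0#      = λ _ → R.0#
    ; 1#      = monomial R.1# 0
    }

  open RawRing powerSeries public
  open RawSemiringDefinitions rawSemiring public using (sum; product; _^_)

  infixl 6 _-_
  infixl 7 _÷_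

  _-_ : Carrier → Carrier → Carrier
  f - g = f + (- g)

  q^_ : ℕ → Carrier
  q^ k = monomial R.1# k

  -- The q-adic limit of the partial sums, provided f k ∈ (q^k) for all k:
  -- the terms with k > n then do not contribute to the coefficient of q^n.
  -- Every family summed in this file satisfies this proviso.
  ∑∞ : (ℕ → Carrier) → Carrier
  ∑∞ f n = sum {suc n} (λ k → f (toℕ k)) n

  -- Likewise the limit of the partial products, provided f k ∈ 1 + (q^k).
  ∏∞ : (ℕ → Carrier) → Carrier
  ∏∞ f n = product {suc n} (λ k → f (toℕ k)) n

  -- The geometric series in 1 - f, which is the reciprocal of f when f has
  -- constant term 1.
  reciprocal : Carrier → Carrier
  reciprocal f = ∑∞ λ k → (1# - f) ^ k

  _÷_ : Carrier → Carrier → Carrier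
  f ÷ g = f * reciprocal g

  -- (a ; q^d)_∞, for d ≥ 1.
  ⟨_⨾q^_⟩∞ : Carrier → ℕ → Carrier
  ⟨ a ⨾q^ d ⟩∞ = ∏∞ λ k → 1# - a * q^ (d ℕ.* k)

open PowerSeries laurent public

z^_ : ℤ → Carrier
z^ e = monomial ((e , ℤ.1ℤ) ∷ []) 0

-- The sum of f m over the integers m with - h ≤ m ≤ h.
∑± : ℕ → (ℤ → Carrier) → Carrier
∑± h f = sum {suc (2 ℕ.* h)} λ i → f (+ toℕ i ℤ.- + h)

S̄ : Carrier
S̄ = ∑∞ λ k → term (suc k)
  where
  term : ℕ → Carrier
  term n = (q^ n * ⟨ q^ (2 ℕ.* n ℕ.+ 2) ⨾q^ 2 ⟩∞)
         ÷ (⟨ z^ (+ 1) * q^ n ⨾q^ 1 ⟩∞ * ⟨ z^ -[1+ 0 ] * q^ n ⨾q^ 1 ⟩∞)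

-- For ∣m∣ ≤ ⌊n/2⌋ the subtraction does not truncate, the division by 2 is
-- exact, and the value is at least n.
qExponent : ℕ → ℤ → ℕ
qExponent n m = (n ℕ.* n ∸ 2 ℕ.* (∣ m ∣ ℕ.* ∣ m ∣) ℕ.+ n) / 2

-- The power of -1 depends only on the parity of m + n, hence the ∣_∣.
summand : ℕ → ℤ → Carrier
summand n m =
    (- 1#) ^ ∣ m ℤ.+ + n ∣
  * (1# - z^ (n-2∣m∣ ℤ.+ + 1))
  * (1# - z^ n-2∣m∣)
  * z^ (ℤ.- n-2∣m∣)
  * q^ (qExponent n m)
  where
  n-2∣m∣ : ℤ
  n-2∣m∣ = + n ℤ.- + (2 ℕ.* ∣ m ∣)

{-# OPTIONS --safe #-}
module Submission where

-- (z ; q)_∞ = (z ; q)_n (z q^n ; q)_∞ turns the left-hand side into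
--
--   (1 + z) (q ; q)_∞ Σ_{n ≥ 1} q^n (z ; q)_n (1/z ; q)_n (q^(2n+2) ; q²)_∞.
--
-- By a finite form of the Jacobi triple product, (1 + z) (z ; q)_n (1/z ; q)_n
-- is a combination, with coefficients free of z, of the Laurent polynomials
-- z^(k+1) + z^(-k).  For n ≥ 1 the coefficients add up to 0, so that
-- z^(k+1) + z^(-k) may be replaced by
--
--   z^(k+1) + z^(-k) - z - 1 = (1 - z^(k+1)) (1 - z^k) z^(-k).
--
-- After exchanging the sums, what multiplies this polynomial is
-- (-1)^k q^(k(k+1)/2) T_k for a q-hypergeometric series T_k.  A telescoping
-- identity gives T_k = 1 - q^(2k+2) - q^(2k+2) T_(k+1); the partial theta
-- series Σ_m (-1)^m q^(2k|m| + m² + |m|) satisfies the same recurrence, and a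
-- solution is determined by its tail, which vanishes q-adically.
--
-- The coefficients of q^n with n < N are computed in the ring of power series
-- modulo q^N, where all sums and products are finite.

-- The factor `(q² ; q²)_n` of the finite triple product completes the numerator `(q^(2n+2) ; q²)_∞`
-- to `(q² ; q²)_∞`, which leaves the sum over `n`; this is what the special numerator is good for.
-- Up to the sign and the power of `q`, the coefficients are q-ballot numbers: the Gaussian
-- binomials `[2n, n-k] - q^(2k+1) [2n, n-k-1]`. The expansion goes by induction on `n`, since the
-- new factor is `(1 - z q^n) (1 - q^n / z) = 1 + q^(2n) - q^n (z + 1/z)`, and `z + 1/z` sends `a_k
-- = z^(k+1) + z^(-k)` to `a_(k+1) + a_(k-1)`, where `a_(-1) = a_0`. The factor `1 + z = a_0` is the
-- start of this induction. Only the action on the `a_k` is used, so the same induction with all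
-- `a_k = 1` and `2` in place of `z + 1/z` shows that the coefficients add up to 0. There is no
-- division. Reciprocals of `(q ; q)_n` are products of truncated geometric sums, and in each
-- identity they are rewritten as multiples of those of largest index. What is left is a polynomial
-- identity in finitely many powers of `q`, within reach of a ring solver.

open import Defs using (Laurent; coeffᶻ; laurent; module PowerSeries)
open import Algebra.Bundles using (CommutativeMonoid; CommutativeRing; Ring)
open import Algebra.Bundles.Raw using (RawRing)
import Algebra.Properties.CommutativeMonoid.Sum as Sums
import Algebra.Properties.Ring as RingProperties
import Algebra.Properties.Semiring.Exp as Exponentiation
import Algebra.Properties.Semiring.Mult.TCOptimised as Multiples
import Algebra.Solver.Ring as RingSolver
open import Algebra.Solver.Ring.AlmostCommutativeRing using (fromCommutativeRing; _-Raw-AlmostCommutative⟶_)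
open import Data.Bool.Base using (if_then_else_; true; false)
open import Data.Fin.Base using (toℕ)
open import Data.Integer.Base as ℤ using (ℤ; +_; -[1+_]; ∣_∣)
import Data.Integer.Properties as ℤ
open import Data.Integer.Tactic.RingSolver using () renaming (solve-∀ to ℤ-solve-∀)
open import Data.List.Base as List using ([]; _∷_)
open import Data.List.Properties using (++-assoc; ++-identityʳ)
open import Data.Maybe.Base as Maybe using (Maybe)
open import Data.Nat.Base as ℕ using (ℕ; zero; suc; _≤_; _<_; z≤n; s≤s; _∸_; _/_)
open import Data.Nat.DivMod using (m/n≤m; m/n*n≤m; m*n/n≡m; /-monoˡ-≤)
import Data.Nat.Properties as ℕ
open import Data.Nat.Tactic.RingSolver using (solve-∀)
open import Data.Product.Base as Product using (_,_)
open import Function.Base using (_∘_)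
open import Level using (0ℓ)
open import Relation.Binary.PropositionalEquality as ≡ using (_≡_; module ≡-Reasoning)
import Relation.Binary.Reasoning.Setoid as SetoidReasoning
open import Relation.Nullary.Decidable using (does; yes; no; dec-true; dec-false)
open import Relation.Nullary.Decidable.Core using (dec⇒maybe)

-- Ring solver with integer coefficients over a commutative ring.

-- The library's solver decides zero only among coefficients, so ℤ is needed
-- for x - x to cancel in an arbitrary commutative ring.
module IntegerSolver {c ℓ} (R : CommutativeRing c ℓ) where

  open CommutativeRing R
  open RingProperties ring
  open Multiples semiring
  open SetoidReasoning setoid

  private
    ⟦_⟧ : ℤ → Carrier
    ⟦ + n ⟧      = n × 1#
    ⟦ -[1+ n ] ⟧ = - (suc n × 1#)

    ⊖-homo : ∀ m n → ⟦ m ℤ.⊖ n ⟧ ≈ m × 1# - n × 1#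
    ⊖-homo m zero = begin
      m × 1#      ≈⟨ +-identityʳ _ ⟨
      m × 1# + 0# ≈⟨ +-congˡ -0#≈0# ⟨
      m × 1# - 0# ∎
    ⊖-homo zero (suc n) = sym (+-identityˡ _)
    ⊖-homo (suc m) (suc n) = begin
      ⟦ suc m ℤ.⊖ suc n ⟧                  ≡⟨ ≡.cong ⟦_⟧ (ℤ.[1+m]⊖[1+n]≡m⊖n m n) ⟩
      ⟦ m ℤ.⊖ n ⟧                          ≈⟨ ⊖-homo m n ⟩
      m × 1# - n × 1#                      ≈⟨ +-congʳ (xyx⁻¹≈y 1# _) ⟨
      1# + m × 1# - 1# - n × 1#            ≈⟨ +-assoc _ _ _ ⟩
      1# + m × 1# + (- 1# - n × 1#)        ≈⟨ +-congˡ (-‿+-comm 1# _) ⟩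
      1# + m × 1# - (1# + n × 1#)          ≈⟨ +-cong (1+× m 1#) (-‿cong (1+× n 1#)) ⟨
      suc m × 1# - suc n × 1#              ∎

    -‿homo : ∀ i → ⟦ ℤ.- i ⟧ ≈ - ⟦ i ⟧
    -‿homo (+ zero)   = sym -0#≈0#
    -‿homo (+ suc n)  = refl
    -‿homo -[1+ n ]   = sym (-‿involutive _)

    +-homo : ∀ i j → ⟦ i ℤ.+ j ⟧ ≈ ⟦ i ⟧ + ⟦ j ⟧
    +-homo (+ m) (+ n)       = ×-homo-+ 1# m n
    +-homo (+ m) -[1+ n ]    = ⊖-homo m (suc n)
    +-homo -[1+ m ] (+ n)    = trans (⊖-homo n (suc m)) (+-comm _ _)
    +-homo -[1+ m ] -[1+ n ] = begin
      - (suc (suc (m ℕ.+ n)) × 1#)        ≡⟨ ≡.cong (λ k → - (suc k × 1#)) (ℕ.+-suc m n) ⟨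
      - ((suc m ℕ.+ suc n) × 1#)          ≈⟨ -‿cong (×-homo-+ 1# (suc m) (suc n)) ⟩
      - (suc m × 1# + suc n × 1#)         ≈⟨ -‿+-comm _ _ ⟨
      - (suc m × 1#) - suc n × 1#         ∎

    ◃-*-homo : ∀ m n → ⟦ + m ℤ.* + n ⟧ ≈ (m × 1#) * (n × 1#)
    ◃-*-homo m n = begin
      ⟦ + m ℤ.* + n ⟧    ≡⟨ ≡.cong ⟦_⟧ (ℤ.pos-* m n) ⟨
      (m ℕ.* n) × 1#     ≈⟨ ×1-homo-* m n ⟩
      (m × 1#) * (n × 1#) ∎

    *-homo : ∀ i j → ⟦ i ℤ.* j ⟧ ≈ ⟦ i ⟧ * ⟦ j ⟧
    *-homo (+ m) (+ n)       = ◃-*-homo m n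
    *-homo (+ m) -[1+ n ]    = begin
      ⟦ + m ℤ.* -[1+ n ] ⟧          ≡⟨ ≡.cong ⟦_⟧ (ℤ.neg-distribʳ-* (+ m) (+ suc n)) ⟨
      ⟦ ℤ.- (+ m ℤ.* + suc n) ⟧     ≈⟨ -‿homo (+ m ℤ.* + suc n) ⟩
      - ⟦ + m ℤ.* + suc n ⟧         ≈⟨ -‿cong (◃-*-homo m (suc n)) ⟩
      - ((m × 1#) * (suc n × 1#))   ≈⟨ -‿distribʳ-* _ _ ⟩
      (m × 1#) * - (suc n × 1#)     ∎
    *-homo -[1+ m ] (+ n)    = begin
      ⟦ -[1+ m ] ℤ.* + n ⟧          ≡⟨ ≡.cong ⟦_⟧ (ℤ.neg-distribˡ-* (+ suc m) (+ n)) ⟨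
      ⟦ ℤ.- (+ suc m ℤ.* + n) ⟧     ≈⟨ -‿homo (+ suc m ℤ.* + n) ⟩
      - ⟦ + suc m ℤ.* + n ⟧         ≈⟨ -‿cong (◃-*-homo (suc m) n) ⟩
      - ((suc m × 1#) * (n × 1#))   ≈⟨ -‿distribˡ-* _ _ ⟩
      - (suc m × 1#) * (n × 1#)     ∎
    *-homo -[1+ m ] -[1+ n ] = begin
      ⟦ -[1+ m ] ℤ.* -[1+ n ] ⟧         ≈⟨ ◃-*-homo (suc m) (suc n) ⟩
      (suc m × 1#) * (suc n × 1#)       ≈⟨ -‿involutive _ ⟨
      - - ((suc m × 1#) * (suc n × 1#)) ≈⟨ -‿cong (-‿distribˡ-* _ _) ⟩
      - (- (suc m × 1#) * (suc n × 1#)) ≈⟨ -‿distribʳ-* _ _ ⟩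
      - (suc m × 1#) * - (suc n × 1#)   ∎

    ℤ⟶R : ℤ.+-*-rawRing -Raw-AlmostCommutative⟶ fromCommutativeRing R
    ℤ⟶R = record
      { ⟦_⟧    = ⟦_⟧
      ; +-homo = +-homo
      ; *-homo = *-homo
      ; -‿homo = -‿homo
      ; 0-homo = refl
      ; 1-homo = refl
      }

    _coeff≟_ : ∀ i j → Maybe (⟦ i ⟧ ≈ ⟦ j ⟧)
    i coeff≟ j = Maybe.map (λ i≡j → reflexive (≡.cong ⟦_⟧ i≡j)) (dec⇒maybe (i ℤ.≟ j))

  open RingSolver ℤ.+-*-rawRing (fromCommutativeRing R) ℤ⟶R _coeff≟_ public

  -- The optimised multiples make `1 × 1#` reduce to `1#`, so that these constants match `0#` and
  -- `1#` in a goal definitionally.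
  :0 :1 : ∀ {n} → Polynomial n
  :0 = con (+ 0)
  :1 = con (+ 1)

-- Finite sums and products over initial segments, and their reindexing.

≤n/2⇒2*≤n : ∀ {n j} → j ≤ n / 2 → 2 ℕ.* j ≤ n
≤n/2⇒2*≤n {n} {j} j≤n/2 = ℕ.≤-trans (ℕ.*-monoʳ-≤ 2 j≤n/2) (≡.subst (_≤ n) (ℕ.*-comm (n / 2) 2) (m/n*n≤m n 2))

module InitialSums {c ℓ} (M : CommutativeMonoid c ℓ) where

  open CommutativeMonoid M
  open Sums M using (sum; ∑-distrib-+; ∑-comm)
  open SetoidReasoning setoid

  -- Opaque, so that summands can be inferred by unification.
  opaque
    sum< : ℕ → (ℕ → Carrier) → Carrier
    sum< n f = sum {n} (f ∘ toℕ)

    sum<≡sum : ∀ n f → sum< n f ≡ sum {n} (f ∘ toℕ)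
    sum<≡sum n f = ≡.refl

    sum<-zero : ∀ f → sum< 0 f ≡ ε
    sum<-zero f = ≡.refl

    sum<-head : ∀ n f → sum< (suc n) f ≡ f 0 ∙ sum< n (f ∘ suc)
    sum<-head n f = ≡.refl

    sum<-cong : ∀ n {f g} → (∀ i → i < n → f i ≈ g i) → sum< n f ≈ sum< n g
    sum<-cong zero    f≈g = refl
    sum<-cong (suc n) f≈g = ∙-cong (f≈g 0 (s≤s z≤n)) (sum<-cong n λ i i<n → f≈g (suc i) (s≤s i<n))

    sum<-ε : ∀ n {f} → (∀ i → i < n → f i ≈ ε) → sum< n f ≈ ε
    sum<-ε zero    f≈ε = refl
    sum<-ε (suc n) f≈ε =
      trans (∙-cong (f≈ε 0 (s≤s z≤n)) (sum<-ε n λ i i<n → f≈ε (suc i) (s≤s i<n))) (identityˡ ε)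

    sum<-+ : ∀ m n f → sum< (m ℕ.+ n) f ≈ sum< m f ∙ sum< n (f ∘ (m ℕ.+_))
    sum<-+ zero    n f = sym (identityˡ _)
    sum<-+ (suc m) n f = trans (∙-congˡ (sum<-+ m n (f ∘ suc))) (sym (assoc _ _ _))

    sum<-suc : ∀ n f → sum< (suc n) f ≈ sum< n f ∙ f n
    sum<-suc zero    f = trans (identityʳ _) (sym (identityˡ _))
    sum<-suc (suc n) f = trans (∙-congˡ (sum<-suc n (f ∘ suc))) (sym (assoc _ _ _))

    sum<-∙ : ∀ n f g → sum< n (λ i → f i ∙ g i) ≈ sum< n f ∙ sum< n g
    sum<-∙ n f g = ∑-distrib-+ {n} (f ∘ toℕ) (g ∘ toℕ)

    sum<-comm : ∀ m n (f : ℕ → ℕ → Carrier) →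
                sum< m (λ i → sum< n (f i)) ≈ sum< n (λ j → sum< m λ i → f i j)
    sum<-comm m n f = ∑-comm {m} {n} λ i j → f (toℕ i) (toℕ j)

  sum<-1 : ∀ f → sum< 1 f ≈ f 0
  sum<-1 f = trans (reflexive (≡.trans (sum<-head 0 f) (≡.cong (f 0 ∙_) (sum<-zero _)))) (identityʳ _)

  sum<-truncate : ∀ {m n f} → m ≤ n → (∀ i → m ≤ i → f i ≈ ε) → sum< n f ≈ sum< m f
  sum<-truncate {m} {n} {f} m≤n f≈ε = begin
    sum< n f                                     ≡⟨ ≡.cong (λ k → sum< k f) (ℕ.m+[n∸m]≡n m≤n) ⟨
    sum< (m ℕ.+ (n ℕ.∸ m)) f                     ≈⟨ sum<-+ m (n ℕ.∸ m) f ⟩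
    sum< m f ∙ sum< (n ℕ.∸ m) (f ∘ (m ℕ.+_))     ≈⟨ ∙-congˡ (sum<-ε (n ℕ.∸ m) λ i _ → f≈ε (m ℕ.+ i) (ℕ.m≤m+n m i)) ⟩
    sum< m f ∙ ε                                 ≈⟨ identityʳ _ ⟩
    sum< m f                                     ∎

  -- The zeros from `n` on allow the range to grow to `k + n` before the `k` zeros at the front are
  -- dropped, so both sums keep the same length.
  sum<-shift : ∀ k n f → (∀ i → i < k → f i ≈ ε) → (∀ i → n ≤ i → f i ≈ ε) →
               sum< n f ≈ sum< n (f ∘ (k ℕ.+_))
  sum<-shift k n f below above = begin
    sum< n f                           ≈⟨ sum<-truncate (ℕ.m≤n+m n k) above ⟨
    sum< (k ℕ.+ n) f                   ≈⟨ sum<-+ k n f ⟩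
    sum< k f ∙ sum< n (f ∘ (k ℕ.+_))   ≈⟨ ∙-congʳ (sum<-ε k below) ⟩
    ε ∙ sum< n (f ∘ (k ℕ.+_))          ≈⟨ identityˡ _ ⟩
    sum< n (f ∘ (k ℕ.+_))              ∎

  -- This is the substitution `n = 2j + k`. Padding the rows with zeros makes a square, whose
  -- columns are then shifted by `2j`; the hypothesis kills the terms that a shift would push beyond
  -- `m`.
  sum<-half : ∀ m (f : ℕ → ℕ → Carrier) → (∀ k j → m ≤ 2 ℕ.* j ℕ.+ k → f k j ≈ ε) →
              sum< m (λ n → sum< (suc (n / 2)) λ j → f (n ℕ.∸ 2 ℕ.* j) j) ≈ sum< m (λ k → sum< m (f k))
  sum<-half m f f≈ε = begin
    sum< m (λ n → sum< (suc (n / 2)) λ j → f (n ℕ.∸ 2 ℕ.* j) j)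
      ≈⟨ sum<-cong m (λ n n<m → sum<-cong (suc (n / 2)) λ j j≤n/2 → reflexive (≡.sym (f′-≥ (≤n/2⇒2*≤n (ℕ.≤-pred j≤n/2))))) ⟩
    sum< m (λ n → sum< (suc (n / 2)) (f′ n))
      ≈⟨ sum<-cong m (λ n n<m → sum<-truncate (ℕ.≤-trans (s≤s (m/n≤m n 2)) n<m) λ j j>n/2 → reflexive (f′-< (n/2<⇒n<2* j>n/2))) ⟨
    sum< m (λ n → sum< m (f′ n))               ≈⟨ sum<-comm m m f′ ⟩
    sum< m (λ j → sum< m λ n → f′ n j)         ≈⟨ sum<-cong m (λ j _ → column j) ⟩
    sum< m (λ j → sum< m λ k → f k j)          ≈⟨ sum<-comm m m (λ j k → f k j) ⟩
    sum< m (λ k → sum< m (f k))                ∎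
    where
    f′ : ℕ → ℕ → Carrier
    f′ n j = if does (2 ℕ.* j ℕ.≤? n) then f (n ℕ.∸ 2 ℕ.* j) j else ε
    f′-≥ : ∀ {n j} → 2 ℕ.* j ≤ n → f′ n j ≡ f (n ℕ.∸ 2 ℕ.* j) j
    f′-≥ {n} {j} 2j≤n = ≡.cong (λ b → if b then f (n ℕ.∸ 2 ℕ.* j) j else ε) (dec-true (2 ℕ.* j ℕ.≤? n) 2j≤n)
    f′-< : ∀ {n j} → n < 2 ℕ.* j → f′ n j ≡ ε
    f′-< {n} {j} n<2j = ≡.cong (λ b → if b then f (n ℕ.∸ 2 ℕ.* j) j else ε) (dec-false (2 ℕ.* j ℕ.≤? n) (ℕ.<⇒≱ n<2j))
    f′-+ : ∀ j k → f′ (2 ℕ.* j ℕ.+ k) j ≡ f k j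
    f′-+ j k = ≡.trans (f′-≥ (ℕ.m≤m+n (2 ℕ.* j) k)) (≡.cong (λ n → f n j) (ℕ.m+n∸m≡n (2 ℕ.* j) k))
    n/2<⇒n<2* : ∀ {n j} → n / 2 < j → n < 2 ℕ.* j
    n/2<⇒n<2* {n} {j} n/2<j = ℕ.≰⇒> λ 2j≤n → ℕ.<⇒≱ n/2<j
      (≡.subst (_≤ n / 2) (m*n/n≡m j 2) (/-monoˡ-≤ 2 (≡.subst (_≤ n) (ℕ.*-comm 2 j) 2j≤n)))
    column : ∀ j → sum< m (λ n → f′ n j) ≈ sum< m (λ k → f k j)
    column j = begin
      sum< m (λ n → f′ n j)                     ≈⟨ sum<-shift (2 ℕ.* j) m (λ n → f′ n j) (λ n n<2j → reflexive (f′-< n<2j)) above ⟩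
      sum< m (λ k → f′ (2 ℕ.* j ℕ.+ k) j)       ≈⟨ sum<-cong m (λ k _ → reflexive (f′-+ j k)) ⟩
      sum< m (λ k → f k j)                      ∎
      where
      above : ∀ n → m ≤ n → f′ n j ≈ ε
      above n m≤n with 2 ℕ.* j ℕ.≤? n
      ... | yes 2j≤n = trans (reflexive (f′-≥ 2j≤n)) (f≈ε (n ℕ.∸ 2 ℕ.* j) j (≡.subst (m ≤_) (≡.sym (ℕ.m+[n∸m]≡n 2j≤n)) m≤n))
      ... | no  2j≰n = reflexive (f′-< (ℕ.≰⇒> 2j≰n))

  sum<-symmetric : ∀ h (f : ℤ → Carrier) →
                   sum< (suc (2 ℕ.* h)) (λ i → f (+ i ℤ.- + h)) ≈ f (+ 0) ∙ sum< h (λ j → f (+ suc j) ∙ f -[1+ j ])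
  sum<-symmetric zero    f = begin
    sum< 1 (λ i → f (+ i ℤ.- + 0))                            ≈⟨ sum<-1 _ ⟩
    f (+ 0)                                                   ≈⟨ identityʳ _ ⟨
    f (+ 0) ∙ ε                                               ≡⟨ ≡.cong (f (+ 0) ∙_) (sum<-zero _) ⟨
    f (+ 0) ∙ sum< 0 (λ j → f (+ suc j) ∙ f -[1+ j ])         ∎
  sum<-symmetric (suc h) f = begin
    sum< (suc (2 ℕ.* suc h)) f⁻                               ≡⟨ ≡.cong (λ m → sum< (suc m) f⁻) (ℕ.*-suc 2 h) ⟩
    sum< (suc (suc (suc (2 ℕ.* h)))) f⁻                       ≡⟨ sum<-head _ f⁻ ⟩
    -- The terms at `- (h + 1)` and `h + 1` are taken off the two ends; in between, the offset of
    -- `i` and the bound drop by 1 together.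
    f -[1+ h ] ∙ sum< (suc (suc (2 ℕ.* h))) (f⁻ ∘ suc)        ≈⟨ ∙-congˡ (sum<-suc _ (f⁻ ∘ suc)) ⟩
    f -[1+ h ] ∙ (sum< (suc (2 ℕ.* h)) (f⁻ ∘ suc) ∙ f⁻ (suc (suc (2 ℕ.* h))))
      ≈⟨ ∙-congˡ (∙-cong (sum<-cong _ λ i _ → reflexive (≡.cong f (inner i))) (reflexive (≡.cong f top))) ⟩
    f -[1+ h ] ∙ (sum< (suc (2 ℕ.* h)) (λ i → f (+ i ℤ.- + h)) ∙ f (+ suc h))
      ≈⟨ ∙-congˡ (∙-congʳ (sum<-symmetric h f)) ⟩
    f -[1+ h ] ∙ (f (+ 0) ∙ S ∙ f (+ suc h))                  ≈⟨ comm _ _ ⟩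
    f (+ 0) ∙ S ∙ f (+ suc h) ∙ f -[1+ h ]                    ≈⟨ assoc _ _ _ ⟩
    f (+ 0) ∙ S ∙ (f (+ suc h) ∙ f -[1+ h ])                  ≈⟨ assoc _ _ _ ⟩
    f (+ 0) ∙ (S ∙ (f (+ suc h) ∙ f -[1+ h ]))                ≈⟨ ∙-congˡ (sum<-suc h _) ⟨
    f (+ 0) ∙ sum< (suc h) (λ j → f (+ suc j) ∙ f -[1+ j ])   ∎
    where
    f⁻ : ℕ → Carrier
    f⁻ i = f (+ i ℤ.- + suc h)
    S : Carrier
    S = sum< h (λ j → f (+ suc j) ∙ f -[1+ j ])
    inner : ∀ i → + suc i ℤ.- + suc h ≡ + i ℤ.- + h
    inner i = ≡.trans (ℤ.[1+m]⊖[1+n]≡m⊖n i h) (≡.sym (ℤ.m-n≡m⊖n i h))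
    top : + suc (suc (2 ℕ.* h)) ℤ.- + suc h ≡ + suc h
    top = ≡.trans (≡.cong (λ m → + m ℤ.- + suc h) (≡.trans (≡.sym (ℕ.*-suc 2 h)) (≡.cong (suc h ℕ.+_) (ℕ.+-identityʳ (suc h)))))
      (≡.trans (ℤ.⊖-≥ {suc h ℕ.+ suc h} (ℕ.m≤m+n (suc h) (suc h))) (≡.cong +_ (ℕ.m+n∸m≡n (suc h) (suc h))))

module InitialRingSums {c ℓ} (R : CommutativeRing c ℓ) where

  open CommutativeRing R
  open InitialSums +-commutativeMonoid public
    renaming (sum<-ε to sum<-0; sum<-∙ to sum<-distrib-+)
  open InitialSums *-commutativeMonoid public
    using ()
    renaming ( sum<          to product<
             ; sum<≡sum      to product<≡product
             ; sum<-zero     to product<-zero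
             ; sum<-head     to product<-head
             ; sum<-cong     to product<-cong
             ; sum<-+        to product<-+
             ; sum<-suc      to product<-suc
             ; sum<-∙        to product<-distrib-*
             ; sum<-1        to product<-1
             ; sum<-truncate to product<-truncate
             )

  open Exponentiation semiring public using (_^_)
  open SetoidReasoning setoid
  open IntegerSolver R

  *-distribˡ-sum< : ∀ n x f → x * sum< n f ≈ sum< n (λ i → x * f i)
  *-distribˡ-sum< zero    x f = begin
    x * sum< 0 f                  ≡⟨ ≡.cong (x *_) (sum<-zero f) ⟩
    x * 0#                        ≈⟨ zeroʳ x ⟩
    0#                            ≡⟨ sum<-zero _ ⟨
    sum< 0 (λ i → x * f i)        ∎
  *-distribˡ-sum< (suc n) x f = begin
    x * sum< (suc n) f                           ≡⟨ ≡.cong (x *_) (sum<-head n f) ⟩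
    x * (f 0 + sum< n (f ∘ suc))                 ≈⟨ distribˡ x _ _ ⟩
    x * f 0 + x * sum< n (f ∘ suc)               ≈⟨ +-congˡ (*-distribˡ-sum< n x (f ∘ suc)) ⟩
    x * f 0 + sum< n (λ i → x * f (suc i))       ≡⟨ sum<-head n _ ⟨
    sum< (suc n) (λ i → x * f i)                 ∎

  geometric : ∀ x n → (1# - x) * sum< n (x ^_) ≈ 1# - x ^ n
  geometric x zero    = begin
    (1# - x) * sum< 0 (x ^_)  ≡⟨ ≡.cong ((1# - x) *_) (sum<-zero (x ^_)) ⟩
    (1# - x) * 0#             ≈⟨ solve 1 (λ x → (:1 :- x) :* :0 := :1 :- :1) refl x ⟩
    1# - 1#                   ∎
  geometric x (suc n) = begin
    (1# - x) * sum< (suc n) (x ^_)               ≡⟨ ≡.cong ((1# - x) *_) (sum<-head n (x ^_)) ⟩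
    (1# - x) * (1# + sum< n (λ i → x * x ^ i))   ≈⟨ *-congˡ (+-congˡ (*-distribˡ-sum< n x (x ^_))) ⟨
    (1# - x) * (1# + x * sum< n (x ^_))          ≈⟨ solve 2 (λ x s → (:1 :- x) :* (:1 :+ x :* s) := (:1 :- x) :+ x :* ((:1 :- x) :* s)) refl x _ ⟩
    (1# - x) + x * ((1# - x) * sum< n (x ^_))    ≈⟨ +-congˡ (*-congˡ (geometric x n)) ⟩
    (1# - x) + x * (1# - x ^ n)                  ≈⟨ solve 2 (λ x p → (:1 :- x) :+ x :* (:1 :- p) := :1 :- x :* p) refl x (x ^ n) ⟩
    1# - x ^ suc n                               ∎

-- Exponents of `q` in the double series.

-- k (k - 1) / 2
tri : ℕ → ℕ
tri zero    = 0
tri (suc k) = tri k ℕ.+ k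

2*tri-suc : ∀ k → tri (suc k) ℕ.* 2 ≡ k ℕ.* k ℕ.+ k
2*tri-suc zero    = ≡.refl
2*tri-suc (suc k) = ≡.trans (ℕ.*-distribʳ-+ 2 (tri (suc k)) (suc k)) (≡.trans (≡.cong (ℕ._+ suc k ℕ.* 2) (2*tri-suc k)) (step k))
  where
  step : ∀ k → k ℕ.* k ℕ.+ k ℕ.+ suc k ℕ.* 2 ≡ suc k ℕ.* suc k ℕ.+ suc k
  step = solve-∀

-- For `j > 0` the cofactor of `j` is at least 2. This bound makes the term for `n = 2j + k`
-- divisible by `q^n`, which justifies both the truncation of the double series and its regrouping
-- by `n`.
exponent-≥ : ∀ k j → 2 ℕ.* j ℕ.+ k ≤ tri (suc k) ℕ.+ j ℕ.* suc (j ℕ.+ 2 ℕ.* k)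
exponent-≥ k zero    = ℕ.≤-trans (ℕ.m≤n+m k (tri k)) (ℕ.m≤m+n _ 0)
exponent-≥ k (suc j) = begin
  2 ℕ.* suc j ℕ.+ k                                        ≡⟨ ℕ.+-comm (2 ℕ.* suc j) k ⟩
  k ℕ.+ 2 ℕ.* suc j                                        ≡⟨ ≡.cong (k ℕ.+_) (ℕ.*-comm 2 (suc j)) ⟩
  k ℕ.+ suc j ℕ.* 2                                        ≤⟨ ℕ.+-mono-≤ (ℕ.m≤n+m k (tri k)) (ℕ.*-monoʳ-≤ (suc j) (s≤s (s≤s z≤n))) ⟩
  tri (suc k) ℕ.+ suc j ℕ.* suc (suc j ℕ.+ 2 ℕ.* k)        ∎
  where open ℕ.≤-Reasoning

-- q-Pochhammer symbols modulo `q^N`.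

-- Q n plays the role of q^n, with q^N = 0.
module TruncatedQSeries
  {c ℓ} (R : CommutativeRing c ℓ) (Q : ℕ → CommutativeRing.Carrier R)
  (Q-0 : CommutativeRing._≈_ R (Q 0) (CommutativeRing.1# R))
  (Q-+ : ∀ m n → CommutativeRing._≈_ R (Q (m ℕ.+ n)) (CommutativeRing._*_ R (Q m) (Q n)))
  (N : ℕ) (Q-≥N : ∀ {n} → N ≤ n → CommutativeRing._≈_ R (Q n) (CommutativeRing.0# R))
  where

  open CommutativeRing R
  open InitialRingSums R
  open IntegerSolver R
  open SetoidReasoning setoid

  q : Carrier
  q = Q 1

  Q-suc : ∀ n → Q (suc n) ≈ q * Q n
  Q-suc = Q-+ 1

  Q-^ : ∀ m n → Q m ^ n ≈ Q (n ℕ.* m)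
  Q-^ m zero    = sym Q-0
  Q-^ m (suc n) = trans (*-congˡ (Q-^ m n)) (sym (Q-+ m (n ℕ.* m)))

  Q-2* : ∀ n → Q (2 ℕ.* n) ≈ Q n * Q n
  Q-2* n = trans (reflexive (≡.cong (λ m → Q (n ℕ.+ m)) (ℕ.+-identityʳ n))) (Q-+ n n)

  1-‿cong : ∀ {x y} → x ≈ y → 1# - x ≈ 1# - y
  1-‿cong x≈y = +-congˡ (-‿cong x≈y)

  poch : Carrier → ℕ → ℕ → Carrier
  poch a d n = product< n λ k → 1# - a * Q (d ℕ.* k)

  poch-cong : ∀ {a b} d n → a ≈ b → poch a d n ≈ poch b d n
  poch-cong d n a≈b = product<-cong n λ k _ → 1-‿cong (*-congʳ a≈b)

  poch-+ : ∀ a d m n → poch a d (m ℕ.+ n) ≈ poch a d m * poch (a * Q (d ℕ.* m)) d n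
  poch-+ a d m n = trans (product<-+ m n _) (*-congˡ (product<-cong n λ k _ → 1-‿cong (begin
    a * Q (d ℕ.* (m ℕ.+ k))           ≡⟨ ≡.cong (λ i → a * Q i) (ℕ.*-distribˡ-+ d m k) ⟩
    a * Q (d ℕ.* m ℕ.+ d ℕ.* k)       ≈⟨ *-congˡ (Q-+ (d ℕ.* m) (d ℕ.* k)) ⟩
    a * (Q (d ℕ.* m) * Q (d ℕ.* k))   ≈⟨ *-assoc _ _ _ ⟨
    a * Q (d ℕ.* m) * Q (d ℕ.* k)     ∎)))

  -- The factors from index `N` on are 1 because `q^N = 0`. Hence `poch a d N` stands for the
  -- infinite product `(a ; q^d)_∞`.
  poch-stable : ∀ a d .{{_ : ℕ.NonZero d}} {n} → N ≤ n → poch a d n ≈ poch a d N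
  poch-stable a d N≤n = product<-truncate N≤n λ k N≤k → begin
    1# - a * Q (d ℕ.* k)  ≈⟨ 1-‿cong (*-congˡ (Q-≥N (ℕ.≤-trans N≤k (ℕ.m≤n*m k d)))) ⟩
    1# - a * 0#           ≈⟨ solve 1 (λ a → :1 :- a :* :0 := :1) refl a ⟩
    1#                    ∎

  poch-tail : ∀ a d .{{_ : ℕ.NonZero d}} n → poch a d N ≈ poch a d n * poch (a * Q (d ℕ.* n)) d N
  poch-tail a d n = trans (sym (poch-stable a d (ℕ.m≤n+m N n))) (poch-+ a d n N)

  O E F : ℕ → Carrier
  O = poch q 2
  E = poch (Q 2) 2
  F = poch q 1

  O-suc : ∀ n → O (suc n) ≈ O n * (1# - Q (suc (2 ℕ.* n)))
  O-suc n = trans (product<-suc n _) (*-congˡ (1-‿cong (sym (Q-+ 1 (2 ℕ.* n)))))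

  E-suc : ∀ n → E (suc n) ≈ E n * (1# - Q (suc (suc (2 ℕ.* n))))
  E-suc n = trans (product<-suc n _) (*-congˡ (1-‿cong (sym (Q-+ 2 (2 ℕ.* n)))))

  F-suc : ∀ n → F (suc n) ≈ F n * (1# - Q (suc n))
  F-suc n = trans (product<-suc n _) (*-congˡ (1-‿cong (begin
    q * Q (1 ℕ.* n)  ≡⟨ ≡.cong (λ i → q * Q i) (ℕ.*-identityˡ n) ⟩
    q * Q n          ≈⟨ Q-suc n ⟨
    Q (suc n)        ∎)))

  O*E≈F : ∀ n → O n * E n ≈ F (2 ℕ.* n)
  O*E≈F zero    = trans (reflexive (≡.cong₂ _*_ (product<-zero _) (product<-zero _))) (trans (*-identityˡ 1#) (reflexive (≡.sym (product<-zero _))))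
  O*E≈F (suc n) = begin
    O (suc n) * E (suc n)                                           ≈⟨ *-cong (O-suc n) (E-suc n) ⟩
    O n * (1# - Q (suc (2 ℕ.* n))) * (E n * (1# - Q (suc (suc (2 ℕ.* n)))))
      ≈⟨ solve 4 (λ o e x y → o :* x :* (e :* y) := o :* e :* x :* y) refl (O n) (E n) _ _ ⟩
    O n * E n * (1# - Q (suc (2 ℕ.* n))) * (1# - Q (suc (suc (2 ℕ.* n))))
      ≈⟨ *-congʳ (*-congʳ (O*E≈F n)) ⟩
    F (2 ℕ.* n) * (1# - Q (suc (2 ℕ.* n))) * (1# - Q (suc (suc (2 ℕ.* n))))
      ≈⟨ *-congʳ (F-suc _) ⟨
    F (suc (2 ℕ.* n)) * (1# - Q (suc (suc (2 ℕ.* n))))              ≈⟨ F-suc _ ⟨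
    F (suc (suc (2 ℕ.* n)))                                         ≡⟨ ≡.cong F (≡.sym (ℕ.*-suc 2 n)) ⟩
    F (2 ℕ.* suc n)                                                 ∎

  -- Reciprocals of `(q ; q)_n`.

  -- 1 / (q ; q)_n
  I : ℕ → Carrier
  I n = product< n λ k → sum< N (Q (suc k) ^_)

  [1-Q]*geometric≈1 : ∀ k → (1# - Q (suc k)) * sum< N (Q (suc k) ^_) ≈ 1#
  [1-Q]*geometric≈1 k = begin
    (1# - Q (suc k)) * sum< N (Q (suc k) ^_)  ≈⟨ geometric (Q (suc k)) N ⟩
    1# - Q (suc k) ^ N                        ≈⟨ 1-‿cong (trans (Q-^ (suc k) N) (Q-≥N (ℕ.m≤m*n N (suc k)))) ⟩
    1# - 0#                                   ≈⟨ solve 0 (:1 :- :0 := :1) refl ⟩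
    1#                                        ∎

  I-suc : ∀ n → I n ≈ (1# - Q (suc n)) * I (suc n)
  I-suc n = begin
    I n                                                      ≈⟨ *-identityʳ _ ⟨
    I n * 1#                                                 ≈⟨ *-congˡ ([1-Q]*geometric≈1 n) ⟨
    I n * ((1# - Q (suc n)) * sum< N (Q (suc n) ^_))         ≈⟨ solve 3 (λ i x g → i :* (x :* g) := x :* (i :* g)) refl (I n) _ _ ⟩
    (1# - Q (suc n)) * (I n * sum< N (Q (suc n) ^_))         ≈⟨ *-congˡ (product<-suc n _) ⟨
    (1# - Q (suc n)) * I (suc n)                             ∎

  F*I≈1 : ∀ n → F n * I n ≈ 1#
  F*I≈1 zero    = trans (reflexive (≡.cong₂ _*_ (product<-zero _) (product<-zero _))) (*-identityˡ 1#)
  F*I≈1 (suc n) = begin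
    F (suc n) * I (suc n)                   ≈⟨ *-congʳ (F-suc n) ⟩
    F n * (1# - Q (suc n)) * I (suc n)      ≈⟨ *-assoc _ _ _ ⟩
    F n * ((1# - Q (suc n)) * I (suc n))    ≈⟨ *-congˡ (I-suc n) ⟨
    F n * I n                               ≈⟨ F*I≈1 n ⟩
    1#                                      ∎

  F∞*I≈1 : ∀ {n} → N ≤ n → F N * I n ≈ 1#
  F∞*I≈1 {n} N≤n = trans (*-congʳ (sym (poch-stable q 1 N≤n))) (F*I≈1 n)

  -- 1 / (q ; q)_(n-k), read as 0 for n < k
  J : ℕ → ℕ → Carrier
  J n       zero    = I n
  J zero    (suc k) = 0#
  J (suc n) (suc k) = J n k

  J-+ : ∀ k r → J (k ℕ.+ r) k ≡ I r
  J-+ zero    r = ≡.refl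
  J-+ (suc k) r = J-+ k r

  J-< : ∀ {n k} → n < k → J n k ≡ 0#
  J-< {zero}  {suc k} _         = ≡.refl
  J-< {suc n} {suc k} (s≤s n<k) = J-< n<k

  -- The factor `1 - Q r` vanishes at `r = 0`, in agreement with the value 0 given to `J` out of
  -- range, so the end of the range needs no case distinction later.
  J-suc : ∀ k r → J (k ℕ.+ r) (suc k) ≈ (1# - Q r) * I r
  J-suc zero    zero    = sym (trans (*-congʳ (trans (1-‿cong Q-0) (-‿inverseʳ 1#))) (zeroˡ _))
  J-suc zero    (suc r) = I-suc r
  J-suc (suc k) r       = J-suc k r

  -- This is `1 / (q ; q)_(r-2) = (1 - q^(r-1)) / (q ; q)_(r-1)` multiplied by `q`, since `r -
  -- 1` is not a natural exponent at `r = 0`. For `r = 1` the factor `q - Q r` is 0, and for `r =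
  -- 0` both values of `J` are.
  J-suc-suc : ∀ k r → q * J (k ℕ.+ r) (suc (suc k)) ≈ (q - Q r) * J (k ℕ.+ r) (suc k)
  J-suc-suc zero    zero          = trans (zeroʳ _) (sym (zeroʳ _))
  J-suc-suc zero    (suc zero)    = trans (zeroʳ _) (sym (trans (*-congʳ (-‿inverseʳ q)) (zeroˡ _)))
  J-suc-suc zero    (suc (suc r)) = begin
    q * I r                                   ≈⟨ *-congˡ (I-suc r) ⟩
    q * ((1# - Q (suc r)) * I (suc r))        ≈⟨ solve 3 (λ q x i → q :* ((:1 :- x) :* i) := (q :- q :* x) :* i) refl q _ _ ⟩
    (q - q * Q (suc r)) * I (suc r)           ≈⟨ *-congʳ (+-congˡ (-‿cong (Q-suc (suc r)))) ⟨
    (q - Q (suc (suc r))) * I (suc r)         ∎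
  J-suc-suc (suc k) r             = J-suc-suc k r

  -- Coefficients of the finite triple product.

  -- In (1 + z) (z ; q)_n (1/z ; q)_n, the coefficient of z^(k+1) + z^(-k) is
  -- (q² ; q²)_n e n k, with e n k = (-1)^k q^(k(k-1)/2) w n k.
  w : ℕ → ℕ → Carrier
  w n k = (1# - Q (suc (2 ℕ.* k))) * (O n * J n k * I (suc (k ℕ.+ n)))

  w-< : ∀ {n k} → n < k → w n k ≈ 0#
  w-< {n} {k} n<k = begin
    w n k                                                       ≡⟨ ≡.cong (λ x → (1# - Q (suc (2 ℕ.* k))) * (O n * x * I (suc (k ℕ.+ n)))) (J-< n<k) ⟩
    (1# - Q (suc (2 ℕ.* k))) * (O n * 0# * I (suc (k ℕ.+ n)))   ≈⟨ solve 3 (λ x o i → x :* (o :* :0 :* i) := :0) refl _ _ _ ⟩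
    0#                                                          ∎

  w-cong : ∀ n k {a b c d} → Q (suc (2 ℕ.* k)) ≈ a → O n ≈ b → J n k ≈ c → I (suc (k ℕ.+ n)) ≈ d →
           w n k ≈ (1# - a) * (b * c * d)
  w-cong n k a b c d = *-cong (1-‿cong a) (*-cong (*-cong b c) d)

  Q-odd : ∀ k {y} → Q k ≈ y → Q (suc (2 ℕ.* k)) ≈ q * (y * y)
  Q-odd k eq = trans (Q-suc _) (*-congˡ (trans (Q-2* k) (*-cong eq eq)))

  Q-even : ∀ k {y} → Q k ≈ y → Q (suc (suc (2 ℕ.* k))) ≈ q * (q * (y * y))
  Q-even k eq = trans (Q-suc _) (*-congˡ (Q-odd k eq))

  -- It is `e-recurrence` with the sign and `q^(tri k)` divided out: the factors `Q k` and
  -- `Q k * Q (suc k)` are what `tri` gains from `k` to `k + 1` and to `k + 2`.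
  w-recurrence :
    ∀ n k → (1# - Q (suc (suc (2 ℕ.* n)))) * (Q k * w (suc n) (suc k))
          ≈ (1# + Q n * Q n) * (Q k * w n (suc k)) + Q n * (w n k + Q k * Q (suc k) * w n (suc (suc k)))
  w-recurrence n k with n ℕ.<? k
  ... | yes n<k = begin
    a * (b * w (suc n) (suc k))                                     ≈⟨ *-congˡ (*-congˡ (w-< (s≤s n<k))) ⟩
    a * (b * 0#)
      ≈⟨ solve 5 (λ a b c d e → a :* (b :* :0) := c :* (b :* :0) :+ d :* (:0 :+ e :* :0)) refl a b s d e ⟩
    s * (b * 0#) + d * (0# + e * 0#)
      ≈⟨ +-cong (*-congˡ (*-congˡ (w-< n<1+k))) (*-congˡ (+-cong (w-< n<k) (*-congˡ (w-< (ℕ.m<n⇒m<1+n n<1+k))))) ⟨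
    s * (b * w n (suc k)) + d * (w n k + e * w n (suc (suc k)))     ∎
    where
    n<1+k = ℕ.m<n⇒m<1+n n<k
    a = 1# - Q (suc (suc (2 ℕ.* n)))
    b = Q k
    s = 1# + Q n * Q n
    d = Q n
    e = Q k * Q (suc k)
  -- With `n = k + r`, everything is a polynomial in `q`, `Y = q^k` and `X = q^r` once the
  -- reciprocals are expressed through `I r` and `I (n + k + 3)`, those of largest index.
  ... | no n≮k with r , ≡.refl ← ℕ.m≤n⇒∃[o]m+o≡n (ℕ.≮⇒≥ n≮k) = begin
    (1# - Q (suc (suc (2 ℕ.* n)))) * (Y * w (suc n) (suc k))
      ≈⟨ *-cong (1-‿cong (Q-even n Qn)) (*-congˡ (w-cong (suc n) (suc k) (Q-odd (suc k) (Q-suc k)) O₁ J₀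
           (reflexive (≡.cong (λ p → I (suc (suc p))) (ℕ.+-suc k n))))) ⟩
    (1# - q * (q * (Y * X * (Y * X)))) * (Y * ((1# - q * (q * Y * (q * Y))) * (o * (1# - q * (Y * X * (Y * X))) * x * i)))
      ≈⟨ solve 6 (λ q Y X o x i →
           (:1 :- q :* (q :* (Y :* X :* (Y :* X)))) :* (Y :* ((:1 :- q :* (q :* Y :* (q :* Y))) :* (o :* (:1 :- q :* (Y :* X :* (Y :* X))) :* x :* i)))
           := (:1 :+ Y :* X :* (Y :* X)) :* (Y :* ((:1 :- q :* (q :* Y :* (q :* Y))) :* (o :* ((:1 :- X) :* x) :* ((:1 :- q :* (q :* (q :* (Y :* (Y :* X))))) :* i))))
           :+ Y :* X :* ((:1 :- q :* (Y :* Y)) :* (o :* x :* ((:1 :- q :* (q :* (Y :* (Y :* X)))) :* ((:1 :- q :* (q :* (q :* (Y :* (Y :* X))))) :* i)))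
             :+ Y :* Y :* ((:1 :- q :* (q :* (q :* Y) :* (q :* (q :* Y)))) :* (o :* ((q :- X) :* ((:1 :- X) :* x)) :* i)))) refl q Y X o x i ⟩
    (1# + Y * X * (Y * X)) * (Y * ((1# - q * (q * Y * (q * Y))) * (o * ((1# - X) * x) * ((1# - q * (q * (q * (Y * (Y * X))))) * i))))
    + Y * X * ((1# - q * (Y * Y)) * (o * x * ((1# - q * (q * (Y * (Y * X)))) * ((1# - q * (q * (q * (Y * (Y * X))))) * i)))
      + Y * Y * ((1# - q * (q * (q * Y) * (q * (q * Y)))) * (o * ((q - X) * ((1# - X) * x)) * i)))
      ≈⟨ +-cong
           (*-cong (+-congˡ (*-cong Qn Qn)) (*-congˡ (w-cong n (suc k) (Q-odd (suc k) (Q-suc k)) refl (J-suc k r) I₁)))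
           (*-cong Qn (+-cong
             (w-cong n k (Q-odd k refl) refl J₀ (trans (I-suc _) (*-cong (1-‿cong (trans (Q-suc _) (*-congˡ Qm))) I₁)))
             w₂)) ⟨
    (1# + Q n * Q n) * (Y * w n (suc k)) + Q n * (w n k + Y * Q (suc k) * w n (suc (suc k)))
      ∎
    where
    Y = Q k
    X = Q r
    o = O n
    x = I r
    i = I (suc (suc (suc (k ℕ.+ n))))
    Qn : Q n ≈ Y * X
    Qn = Q-+ k r
    Qm : Q (suc (k ℕ.+ n)) ≈ q * (Y * (Y * X))
    Qm = trans (Q-suc _) (*-congˡ (trans (Q-+ k n) (*-congˡ Qn)))
    O₁ : O (suc n) ≈ o * (1# - q * (Y * X * (Y * X)))
    O₁ = trans (O-suc n) (*-congˡ (1-‿cong (Q-odd n Qn)))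
    J₀ : J n k ≈ x
    J₀ = reflexive (J-+ k r)
    I₁ : I (suc (suc (k ℕ.+ n))) ≈ (1# - q * (q * (q * (Y * (Y * X))))) * i
    I₁ = trans (I-suc _) (*-congʳ (1-‿cong (trans (Q-suc _) (*-congˡ (trans (Q-suc _) (*-congˡ Qm))))))
    w₂ : Y * Q (suc k) * w n (suc (suc k))
         ≈ Y * Y * ((1# - q * (q * (q * Y) * (q * (q * Y)))) * (o * ((q - X) * ((1# - X) * x)) * i))
    w₂ = begin
      Y * Q (suc k) * w n (suc (suc k))
        ≈⟨ *-cong (*-congˡ (Q-suc k)) (w-cong n (suc (suc k)) (Q-odd (suc (suc k)) (trans (Q-suc _) (*-congˡ (Q-suc k)))) refl refl refl) ⟩
      Y * (q * Y) * ((1# - q * (q * (q * Y) * (q * (q * Y)))) * (o * J n (suc (suc k)) * i))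
        ≈⟨ solve 6 (λ q Y o i a j → Y :* (q :* Y) :* (a :* (o :* j :* i)) := Y :* Y :* (a :* (o :* (q :* j) :* i))) refl q Y o i _ _ ⟩
      Y * Y * ((1# - q * (q * (q * Y) * (q * (q * Y)))) * (o * (q * J n (suc (suc k))) * i))
        ≈⟨ *-congˡ (*-congˡ (*-congʳ (*-congˡ (trans (J-suc-suc k r) (*-congˡ (J-suc k r)))))) ⟩
      Y * Y * ((1# - q * (q * (q * Y) * (q * (q * Y)))) * (o * ((q - X) * ((1# - X) * x)) * i)) ∎

  -- At the end `k = 0` the missing neighbour `e n (-1)` is replaced by `e n 0`, reflecting
  -- `a_(-1) = a_0`. The minus sign before `w n 1` is that of `e n 1`.
  w-recurrence₀ :
    ∀ n → (1# - Q (suc (suc (2 ℕ.* n)))) * w (suc n) 0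
        ≈ (1# + Q n * Q n) * w n 0 - Q n * (w n 0 - w n 1)
  w-recurrence₀ n = begin
    (1# - Q (suc (suc (2 ℕ.* n)))) * w (suc n) 0
      ≈⟨ *-cong (1-‿cong (Q-even n refl)) (w-cong (suc n) 0 refl (trans (O-suc n) (*-congˡ (1-‿cong (Q-odd n refl)))) refl refl) ⟩
    (1# - q * (q * (X * X))) * ((1# - q) * (o * (1# - q * (X * X)) * x * i))
      ≈⟨ solve 5 (λ q X o x i →
           (:1 :- q :* (q :* (X :* X))) :* ((:1 :- q) :* (o :* (:1 :- q :* (X :* X)) :* x :* i))
           := (:1 :+ X :* X) :* ((:1 :- q) :* (o :* ((:1 :- q :* X) :* x) :* ((:1 :- q :* (q :* X)) :* i)))
           :- X :* ((:1 :- q) :* (o :* ((:1 :- q :* X) :* x) :* ((:1 :- q :* (q :* X)) :* i))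
             :- (:1 :- q :* (q :* q)) :* (o :* ((:1 :- X) :* ((:1 :- q :* X) :* x)) :* i)))
           refl q X o x i ⟩
    (1# + X * X) * w₀ - X * (w₀ - (1# - q * (q * q)) * (o * ((1# - X) * ((1# - q * X) * x)) * i))
      ≈⟨ +-cong (*-congˡ w≈w₀) (-‿cong (*-congˡ (+-cong w≈w₀ (-‿cong
           (w-cong n 1 (Q-odd 1 refl) refl (trans (J-suc 0 n) (*-congˡ Iₙ)) refl))))) ⟨
    (1# + X * X) * w n 0 - X * (w n 0 - w n 1) ∎
    where
    X = Q n
    o = O n
    x = I (suc n)
    i = I (suc (suc n))
    w₀ = (1# - q) * (o * ((1# - q * X) * x) * ((1# - q * (q * X)) * i))
    Iₙ : I n ≈ (1# - q * X) * x
    Iₙ = trans (I-suc n) (*-congʳ (1-‿cong (Q-suc n)))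
    w≈w₀ : w n 0 ≈ w₀
    w≈w₀ = w-cong n 0 refl refl Iₙ (trans (I-suc _) (*-congʳ (1-‿cong (trans (Q-suc _) (*-congˡ (Q-suc n))))))

  sgn : ℕ → Carrier
  sgn zero    = 1#
  sgn (suc k) = - sgn k

  e : ℕ → ℕ → Carrier
  e n k = sgn k * (Q (tri k) * w n k)

  e-< : ∀ {n k} → n < k → e n k ≈ 0#
  e-< n<k = trans (*-congˡ (trans (*-congˡ (w-< n<k)) (zeroʳ _))) (zeroʳ _)

  e-recurrence :
    ∀ n k → (1# - Q (suc (suc (2 ℕ.* n)))) * e (suc n) (suc k)
          ≈ (1# + Q n * Q n) * e n (suc k) - Q n * (e n k + e n (suc (suc k)))
  e-recurrence n k = begin
    u * (- s * (Q (t ℕ.+ k) * w₁))                  ≈⟨ *-congˡ (*-congˡ (*-congʳ (Q-+ t k))) ⟩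
    u * (- s * (Q t * Q k * w₁))
      ≈⟨ solve 5 (λ u s t y w₁ → u :* (:- s :* (t :* y :* w₁)) := :- (s :* t) :* (u :* (y :* w₁))) refl u s (Q t) (Q k) w₁ ⟩
    - (s * Q t) * (u * (Q k * w₁))                  ≈⟨ *-congˡ (w-recurrence n k) ⟩
    - (s * Q t) * ((1# + Q n * Q n) * (Q k * w n (suc k)) + Q n * (w n k + Q k * Q (suc k) * w n (suc (suc k))))
      ≈⟨ solve 8 (λ s t m y z a b d →
           :- (s :* t) :* ((:1 :+ m :* m) :* (y :* b) :+ m :* (a :+ y :* z :* d))
           := (:1 :+ m :* m) :* (:- s :* (t :* y :* b)) :- m :* (s :* (t :* a) :+ :- :- s :* (t :* y :* z :* d)))
           refl s (Q t) (Q n) (Q k) (Q (suc k)) (w n k) (w n (suc k)) (w n (suc (suc k))) ⟩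
    (1# + Q n * Q n) * (- s * (Q t * Q k * w n (suc k)))
    - Q n * (s * (Q t * w n k) + - - s * (Q t * Q k * Q (suc k) * w n (suc (suc k))))
      ≈⟨ +-cong (*-congˡ (*-congˡ (*-congʳ (Q-+ t k)))) (-‿cong (*-congˡ (+-congˡ (*-congˡ (*-congʳ
           (trans (Q-+ (t ℕ.+ k) (suc k)) (*-congʳ (Q-+ t k)))))))) ⟨
    (1# + Q n * Q n) * e n (suc k) - Q n * (e n k + e n (suc (suc k))) ∎
    where
    u = 1# - Q (suc (suc (2 ℕ.* n)))
    s = sgn k
    t = tri k
    w₁ = w (suc n) (suc k)

  e-recurrence₀ :
    ∀ n → (1# - Q (suc (suc (2 ℕ.* n)))) * e (suc n) 0
        ≈ (1# + Q n * Q n) * e n 0 - Q n * (e n 0 + e n 1)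
  e-recurrence₀ n = begin
    u * (1# * (Q 0 * w (suc n) 0))                  ≈⟨ solve 3 (λ u z w → u :* (:1 :* (z :* w)) := z :* (u :* w)) refl u (Q 0) _ ⟩
    Q 0 * (u * w (suc n) 0)                         ≈⟨ *-congˡ (w-recurrence₀ n) ⟩
    Q 0 * ((1# + Q n * Q n) * w n 0 - Q n * (w n 0 - w n 1))
      ≈⟨ solve 4 (λ z m a b →
           z :* ((:1 :+ m :* m) :* a :- m :* (a :- b))
           := (:1 :+ m :* m) :* (:1 :* (z :* a)) :- m :* (:1 :* (z :* a) :+ :- :1 :* (z :* b)))
           refl (Q 0) (Q n) (w n 0) (w n 1) ⟩
    (1# + Q n * Q n) * e n 0 - Q n * (e n 0 + e n 1) ∎
    where
    u = 1# - Q (suc (suc (2 ℕ.* n)))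

  e-0-0 : e 0 0 ≈ 1#
  e-0-0 = begin
    1# * (Q 0 * ((1# - q) * (O 0 * I 0 * I 1)))
      ≈⟨ *-congˡ (*-cong Q-0 (*-congˡ (*-congʳ (*-congʳ (reflexive (product<-zero _)))))) ⟩
    1# * (1# * ((1# - q) * (1# * I 0 * I 1)))
      ≈⟨ solve 3 (λ q i j → :1 :* (:1 :* ((:1 :- q) :* (:1 :* i :* j))) := (:1 :- q) :* j :* i) refl q (I 0) (I 1) ⟩
    (1# - q) * I 1 * I 0         ≈⟨ *-cong (sym (I-suc 0)) (reflexive (product<-zero _)) ⟩
    I 0 * 1#                     ≈⟨ *-congʳ (reflexive (product<-zero _)) ⟩
    1# * 1#                      ≈⟨ *-identityˡ 1# ⟩
    1#                           ∎

  -- Expansion of the product along an eigenvector of the second difference.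

  module _ {a : ℕ → Carrier} {ω : Carrier}
           (ω*a₀ : ω * a 0 ≈ a 1 + a 0)
           (ω*a₊ : ∀ k → ω * a (suc k) ≈ a (suc (suc k)) + a k) where

    -- Green's identity for the second-difference operator: only boundary terms survive.
    green : ∀ {x y : ℕ → Carrier} {α β} →
            y 0 ≈ α * x 0 - β * (x 0 + x 1) →
            (∀ k → y (suc k) ≈ α * x (suc k) - β * (x k + x (suc (suc k)))) →
            ∀ n → sum< (suc n) (λ k → y k * a k)
                ≈ (α - β * ω) * sum< (suc n) (λ k → x k * a k) + β * (x n * a (suc n) - x (suc n) * a n)
    green {x} {y} {α} {β} y₀ y₊ zero = begin
      sum< 1 (λ k → y k * a k)                       ≈⟨ sum<-1 _ ⟩
      y 0 * a 0                                      ≈⟨ *-congʳ y₀ ⟩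
      (α * x 0 - β * (x 0 + x 1)) * a 0
        ≈⟨ solve 6 (λ α β x₀ x₁ a₀ a₁ →
             (α :* x₀ :- β :* (x₀ :+ x₁)) :* a₀ := α :* (x₀ :* a₀) :- β :* (x₀ :* (a₁ :+ a₀)) :+ β :* (x₀ :* a₁ :- x₁ :* a₀))
             refl α β (x 0) (x 1) (a 0) (a 1) ⟩
      α * (x 0 * a 0) - β * (x 0 * (a 1 + a 0)) + β * (x 0 * a 1 - x 1 * a 0)
        ≈⟨ +-congʳ (+-congˡ (-‿cong (*-congˡ (*-congˡ ω*a₀)))) ⟨
      α * (x 0 * a 0) - β * (x 0 * (ω * a 0)) + β * (x 0 * a 1 - x 1 * a 0)
        ≈⟨ +-congʳ (solve 5 (λ α β ω x₀ a₀ → α :* (x₀ :* a₀) :- β :* (x₀ :* (ω :* a₀)) := (α :- β :* ω) :* (x₀ :* a₀)) refl α β ω (x 0) (a 0)) ⟩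
      (α - β * ω) * (x 0 * a 0) + β * (x 0 * a 1 - x 1 * a 0)
        ≈⟨ +-congʳ (*-congˡ (sum<-1 _)) ⟨
      (α - β * ω) * sum< 1 (λ k → x k * a k) + β * (x 0 * a 1 - x 1 * a 0) ∎
    green {x} {y} {α} {β} y₀ y₊ (suc n) = begin
      sum< (suc (suc n)) (λ k → y k * a k)                         ≈⟨ sum<-suc (suc n) _ ⟩
      sum< (suc n) (λ k → y k * a k) + y (suc n) * a (suc n)       ≈⟨ +-cong (green y₀ y₊ n) (*-congʳ (y₊ n)) ⟩
      (α - β * ω) * S + β * (x n * a₁ - x₁ * a n) + (α * x₁ - β * (x n + x₂)) * a₁
        ≈⟨ solve 10 (λ α β ω S x₀ x₁ x₂ a₀ a₁ a₂ →
             (α :- β :* ω) :* S :+ β :* (x₀ :* a₁ :- x₁ :* a₀) :+ (α :* x₁ :- β :* (x₀ :+ x₂)) :* a₁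
             := (α :- β :* ω) :* S :+ (α :* (x₁ :* a₁) :- β :* (x₁ :* (a₂ :+ a₀))) :+ β :* (x₁ :* a₂ :- x₂ :* a₁))
             refl α β ω S (x n) x₁ x₂ (a n) a₁ a₂ ⟩
      (α - β * ω) * S + (α * (x₁ * a₁) - β * (x₁ * (a₂ + a n))) + β * (x₁ * a₂ - x₂ * a₁)
        ≈⟨ +-congʳ (+-congˡ (+-congˡ (-‿cong (*-congˡ (*-congˡ (ω*a₊ n)))))) ⟨
      (α - β * ω) * S + (α * (x₁ * a₁) - β * (x₁ * (ω * a₁))) + β * (x₁ * a₂ - x₂ * a₁)
        ≈⟨ +-congʳ (solve 6 (λ α β ω S x a → (α :- β :* ω) :* S :+ (α :* (x :* a) :- β :* (x :* (ω :* a))) := (α :- β :* ω) :* (S :+ x :* a)) refl α β ω S x₁ a₁) ⟩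
      (α - β * ω) * (S + x₁ * a₁) + β * (x₁ * a₂ - x₂ * a₁)
        ≈⟨ +-congʳ (*-congˡ (sum<-suc (suc n) _)) ⟨
      (α - β * ω) * sum< (suc (suc n)) (λ k → x k * a k) + β * (x₁ * a₂ - x₂ * a₁) ∎
      where
      S = sum< (suc n) (λ k → x k * a k)
      x₁ = x (suc n)
      x₂ = x (suc (suc n))
      a₁ = a (suc n)
      a₂ = a (suc (suc n))

    -- Multiplication by one more factor acts on `a` through `ω`, and `green` moves that action to
    -- the coefficients, where it is the recurrence of `e`. The sum runs up to `k = N` for every
    -- `n`, so that the coefficients at `N` and `N + 1` in the boundary term still vanish when
    -- passing from `n < N` to `n + 1`. It is applied to `z^(k+1) + z^(-k)` and to the constant 1.
    product-expansion :
      ∀ n → n ≤ N → product< n (λ i → 1# + Q i * Q i - Q i * ω) * a 0 ≈ E n * sum< (suc N) (λ k → e n k * a k)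
    product-expansion zero    _   = begin
      product< 0 (λ i → 1# + Q i * Q i - Q i * ω) * a 0  ≈⟨ *-cong (reflexive (product<-zero _)) (sym (*-identityˡ _)) ⟩
      1# * (1# * a 0)                                   ≈⟨ *-cong (reflexive (product<-zero _)) (*-congʳ e-0-0) ⟨
      E 0 * (e 0 0 * a 0)                               ≈⟨ *-congˡ (sum<-1 _) ⟨
      E 0 * sum< 1 (λ k → e 0 k * a k)
        ≈⟨ *-congˡ (sum<-truncate (s≤s z≤n) λ k 0<k → trans (*-congʳ (e-< 0<k)) (zeroˡ _)) ⟨
      E 0 * sum< (suc N) (λ k → e 0 k * a k)            ∎
    product-expansion (suc n) n<N = begin
      product< (suc n) f * a 0                          ≈⟨ *-congʳ (product<-suc n f) ⟩
      product< n f * f n * a 0                          ≈⟨ solve 3 (λ x y z → x :* y :* z := y :* (x :* z)) refl _ (f n) (a 0) ⟩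
      f n * (product< n f * a 0)                        ≈⟨ *-congˡ (product-expansion n (ℕ.<⇒≤ n<N)) ⟩
      f n * (E n * S)                                   ≈⟨ solve 3 (λ x y z → x :* (y :* z) := y :* (x :* z :+ :0)) refl (f n) (E n) S ⟩
      E n * (f n * S + 0#)                              ≈⟨ *-congˡ (+-congˡ boundary≈0) ⟨
      E n * (f n * S + Q n * (e n N * a (suc N) - e n (suc N) * a N))
        ≈⟨ *-congˡ (green (e-recurrence₀ n) (e-recurrence n) N) ⟨
      E n * sum< (suc N) (λ k → d * e (suc n) k * a k)
        ≈⟨ *-congˡ (sum<-cong (suc N) λ k _ → *-assoc _ _ _) ⟩
      E n * sum< (suc N) (λ k → d * (e (suc n) k * a k))
        ≈⟨ *-congˡ (*-distribˡ-sum< (suc N) d _) ⟨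
      E n * (d * sum< (suc N) (λ k → e (suc n) k * a k)) ≈⟨ *-assoc _ _ _ ⟨
      E n * d * sum< (suc N) (λ k → e (suc n) k * a k)   ≈⟨ *-congʳ (E-suc n) ⟨
      E (suc n) * sum< (suc N) (λ k → e (suc n) k * a k) ∎
      where
      f = λ i → 1# + Q i * Q i - Q i * ω
      S = sum< (suc N) (λ k → e n k * a k)
      d = 1# - Q (suc (suc (2 ℕ.* n)))
      boundary≈0 : Q n * (e n N * a (suc N) - e n (suc N) * a N) ≈ 0#
      boundary≈0 = begin
        Q n * (e n N * a (suc N) - e n (suc N) * a N)
          ≈⟨ *-congˡ (+-cong (*-congʳ (e-< n<N)) (-‿cong (*-congʳ (e-< (ℕ.m<n⇒m<1+n n<N))))) ⟩
        Q n * (0# * a (suc N) - 0# * a N)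
          ≈⟨ solve 3 (λ x y z → x :* (:0 :* y :- :0 :* z) := :0) refl (Q n) _ _ ⟩
        0# ∎

  -- The series `T k` and its recurrence by telescoping.

  v : ℕ → ℕ → Carrier
  v k r = Q r * w (k ℕ.+ r) k

  -- The partial sums over r of v k r + q^(2k+2) v (k+1) r.
  u : ℕ → ℕ → Carrier
  u k r = O (suc (k ℕ.+ r)) * (1# - Q 2+2k + Q 2+2k * Q r * (1# - q)) * (I r * I (suc (suc (suc (k ℕ.+ (k ℕ.+ r))))))
    where
    2+2k = suc (suc (2 ℕ.* k))

  v-telescope₀ : ∀ k → v k 0 + Q (suc (suc (2 ℕ.* k))) * v (suc k) 0 ≈ u k 0
  v-telescope₀ k = begin
    v k 0 + Q (suc (suc (2 ℕ.* k))) * v (suc k) 0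
      ≈⟨ +-cong (*-cong Q-0 (w-cong n k (Q-odd k refl) refl J₀ I₁))
                (*-cong (Q-even k refl) (*-cong Q-0 (w-cong (suc n) (suc k) (Q-odd (suc k) (Q-suc k)) O₁ J₀
                  (reflexive (≡.cong (λ m → I (suc (suc m))) (ℕ.+-suc k n)))))) ⟩
    1# * ((1# - q * (Y * Y)) * (o * i₀ * ((1# - q * (q * (Y * Y))) * ((1# - q * (q * (q * (Y * Y)))) * i))))
    + q * (q * (Y * Y)) * (1# * ((1# - q * (q * Y * (q * Y))) * (o * (1# - q * (Y * Y)) * i₀ * i)))
      ≈⟨ solve 5 (λ q Y o i₀ i →
           :1 :* ((:1 :- q :* (Y :* Y)) :* (o :* i₀ :* ((:1 :- q :* (q :* (Y :* Y))) :* ((:1 :- q :* (q :* (q :* (Y :* Y)))) :* i))))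
           :+ q :* (q :* (Y :* Y)) :* (:1 :* ((:1 :- q :* (q :* Y :* (q :* Y))) :* (o :* (:1 :- q :* (Y :* Y)) :* i₀ :* i)))
           := o :* (:1 :- q :* (Y :* Y)) :* (:1 :- q :* (q :* (Y :* Y)) :+ q :* (q :* (Y :* Y)) :* :1 :* (:1 :- q)) :* (i₀ :* i))
           refl q Y o i₀ i ⟩
    o * (1# - q * (Y * Y)) * (1# - q * (q * (Y * Y)) + q * (q * (Y * Y)) * 1# * (1# - q)) * (i₀ * i)
      ≈⟨ *-congʳ (*-cong O₁ (+-cong (1-‿cong (Q-even k refl)) (*-congʳ (*-cong (Q-even k refl) Q-0)))) ⟨
    u k 0 ∎
    where
    n = k ℕ.+ 0
    Y = Q k
    o = O n
    i₀ = I 0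
    i = I (suc (suc (suc (k ℕ.+ n))))
    Qn : Q n ≈ Y
    Qn = reflexive (≡.cong Q (ℕ.+-identityʳ k))
    J₀ : J n k ≈ i₀
    J₀ = reflexive (J-+ k 0)
    O₁ : O (suc n) ≈ o * (1# - q * (Y * Y))
    O₁ = trans (O-suc n) (*-congˡ (1-‿cong (Q-odd n Qn)))
    Qm : Q (suc (suc (k ℕ.+ n))) ≈ q * (q * (Y * Y))
    Qm = trans (Q-suc _) (*-congˡ (trans (Q-suc _) (*-congˡ (trans (Q-+ k n) (*-congˡ Qn)))))
    I₁ : I (suc (k ℕ.+ n)) ≈ (1# - q * (q * (Y * Y))) * ((1# - q * (q * (q * (Y * Y)))) * i)
    I₁ = trans (I-suc _) (*-cong (1-‿cong Qm) (trans (I-suc _) (*-congʳ (1-‿cong (trans (Q-suc _) (*-congˡ Qm))))))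

  -- With the weight `q^(2k+2)`, the two terms combine to the difference of the closed form `u k`,
  -- its q-hypergeometric antidifference. As `v (suc k) r` belongs to `n = k + 1 + r`, both terms
  -- share `1 / (q ; q)_r`, and the check is again polynomial in `q`, `q^k` and `q^r`.
  v-telescope : ∀ k r → u k r + (v k (suc r) + Q (suc (suc (2 ℕ.* k))) * v (suc k) (suc r)) ≈ u k (suc r)
  v-telescope k r = begin
    u k r + (v k (suc r) + Q (suc (suc (2 ℕ.* k))) * v (suc k) (suc r))
      ≈⟨ +-cong (*-cong (*-congˡ (+-cong (1-‿cong Q₂) (*-congʳ (*-congʳ Q₂)))) (*-cong (trans (I-suc r) (*-congʳ (1-‿cong (Q-suc r)))) I₃))
           (+-cong (*-cong (Q-suc r) (trans (reflexive (≡.cong (λ m → w m k) k+1+r)) (w-cong (suc n) k (Q-odd k refl) refl J₁ I₂)))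
             (*-cong Q₂ (*-cong (Q-suc r) (trans (reflexive (≡.cong (λ m → w (suc m) (suc k)) k+1+r))
               (w-cong (suc (suc n)) (suc k) (Q-odd (suc k) (Q-suc k)) O₁ J₁ I₄))))) ⟩
    o * (1# - q * (q * (Y * Y)) + q * (q * (Y * Y)) * y * (1# - q)) * ((1# - q * y) * i₁ * ((1# - x₄) * i))
    + (q * y * ((1# - q * (Y * Y)) * (o * i₁ * ((1# - x₃) * ((1# - x₄) * i))))
      + q * (q * (Y * Y)) * (q * y * ((1# - q * (q * Y * (q * Y))) * (o * (1# - x₁) * i₁ * i))))
      ≈⟨ solve 6 (λ q Y y o i₁ i →
           let x₁ = q :* (q :* (Y :* y) :* (q :* (Y :* y)))
               x₃ = q :* (q :* (q :* (Y :* (Y :* y))))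
               x₄ = q :* x₃
           in o :* (:1 :- q :* (q :* (Y :* Y)) :+ q :* (q :* (Y :* Y)) :* y :* (:1 :- q)) :* ((:1 :- q :* y) :* i₁ :* ((:1 :- x₄) :* i))
              :+ (q :* y :* ((:1 :- q :* (Y :* Y)) :* (o :* i₁ :* ((:1 :- x₃) :* ((:1 :- x₄) :* i))))
                :+ q :* (q :* (Y :* Y)) :* (q :* y :* ((:1 :- q :* (q :* Y :* (q :* Y))) :* (o :* (:1 :- x₁) :* i₁ :* i))))
              := o :* (:1 :- x₁) :* (:1 :- q :* (q :* (Y :* Y)) :+ q :* (q :* (Y :* Y)) :* (q :* y) :* (:1 :- q)) :* (i₁ :* i))
           refl q Y y o i₁ i ⟩
    o * (1# - x₁) * (1# - q * (q * (Y * Y)) + q * (q * (Y * Y)) * (q * y) * (1# - q)) * (i₁ * i)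
      ≈⟨ *-cong (*-cong (trans (reflexive (≡.cong (λ m → O (suc m)) k+1+r)) O₁)
                        (+-cong (1-‿cong Q₂) (*-congʳ (*-cong Q₂ (Q-suc r)))))
                (*-congˡ (trans (reflexive (≡.cong (λ m → I (suc (suc (suc (k ℕ.+ m))))) k+1+r))
                  (reflexive (≡.cong (λ m → I (suc (suc (suc m)))) (ℕ.+-suc k n))))) ⟨
    u k (suc r) ∎
    where
    n = k ℕ.+ r
    Y = Q k
    y = Q r
    o = O (suc n)
    i₁ = I (suc r)
    i = I (suc (suc (suc (suc (k ℕ.+ n)))))
    x₁ = q * (q * (Y * y) * (q * (Y * y)))
    x₃ = q * (q * (q * (Y * (Y * y))))
    x₄ = q * x₃
    k+1+r : k ℕ.+ suc r ≡ suc n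
    k+1+r = ℕ.+-suc k r
    Q₂ : Q (suc (suc (2 ℕ.* k))) ≈ q * (q * (Y * Y))
    Q₂ = Q-even k refl
    J₁ : J (suc n) k ≈ i₁
    J₁ = reflexive (≡.trans (≡.cong (λ m → J m k) (≡.sym k+1+r)) (J-+ k (suc r)))
    O₁ : O (suc (suc n)) ≈ o * (1# - x₁)
    O₁ = trans (O-suc (suc n)) (*-congˡ (1-‿cong (Q-odd (suc n) (trans (Q-suc n) (*-congˡ (Q-+ k r))))))
    Q₃ : Q (suc (suc (suc (k ℕ.+ n)))) ≈ x₃
    Q₃ = trans (Q-suc _) (*-congˡ (trans (Q-suc _) (*-congˡ (trans (Q-suc _) (*-congˡ (trans (Q-+ k n) (*-congˡ (Q-+ k r))))))))
    I₃ : I (suc (suc (suc (k ℕ.+ n)))) ≈ (1# - x₄) * i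
    I₃ = trans (I-suc _) (*-congʳ (1-‿cong (trans (Q-suc _) (*-congˡ Q₃))))
    I₂ : I (suc (k ℕ.+ suc n)) ≈ (1# - x₃) * ((1# - x₄) * i)
    I₂ = trans (reflexive (≡.cong (λ m → I (suc m)) (ℕ.+-suc k n))) (trans (I-suc _) (*-cong (1-‿cong Q₃) I₃))
    I₄ : I (suc (suc (k ℕ.+ suc (suc n)))) ≈ i
    I₄ = reflexive (≡.cong (λ m → I (suc (suc m))) (≡.trans (ℕ.+-suc k (suc n)) (≡.cong suc (ℕ.+-suc k n))))

  v-sum : ∀ k m → sum< (suc m) (λ r → v k r + Q (suc (suc (2 ℕ.* k))) * v (suc k) r) ≈ u k m
  v-sum k zero    = trans (sum<-1 _) (v-telescope₀ k)
  v-sum k (suc m) = trans (sum<-suc (suc m) _) (trans (+-congʳ (v-sum k m)) (v-telescope k m))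

  -- At `r = N` the power `q^r` vanishes, which leaves `1 - q^(2k+2)` of the middle factor of `u`.
  -- Because `(q ; q²)_∞ (q² ; q²)_∞ = (q ; q)_∞`, the other factors are `(q ; q)_∞²` against two
  -- reciprocals of `(q ; q)_∞`.
  F∞*E∞*u∞ : ∀ k → F N * E N * u k N ≈ 1# - Q (suc (suc (2 ℕ.* k)))
  F∞*E∞*u∞ k = begin
    F N * E N * (O (suc (k ℕ.+ N)) * (1# - c₂ + c₂ * Q N * (1# - q)) * (I N * I (suc (suc (suc m)))))
      ≈⟨ *-congˡ (*-congʳ (*-cong (poch-stable q 2 N≤1+k+N) (+-congˡ (*-congʳ (*-congˡ (Q-≥N ℕ.≤-refl)))))) ⟩
    F N * E N * (O N * (1# - c₂ + c₂ * 0# * (1# - q)) * (I N * I (suc (suc (suc m)))))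
      ≈⟨ solve 7 (λ f e o c q i j → f :* e :* (o :* (:1 :- c :+ c :* :0 :* (:1 :- q)) :* (i :* j))
                                  := o :* e :* i :* (f :* j) :* (:1 :- c)) refl (F N) (E N) (O N) c₂ q (I N) _ ⟩
    O N * E N * I N * (F N * I (suc (suc (suc m)))) * (1# - c₂)
      ≈⟨ *-congʳ (*-cong (*-congʳ (trans (O*E≈F N) (poch-stable q 1 (ℕ.m≤m+n N _)))) (F∞*I≈1 N≤3+m)) ⟩
    F N * I N * 1# * (1# - c₂)   ≈⟨ *-congʳ (*-congʳ (F*I≈1 N)) ⟩
    1# * 1# * (1# - c₂)          ≈⟨ solve 1 (λ c → :1 :* :1 :* c := c) refl (1# - c₂) ⟩
    1# - c₂                      ∎
    where
    c₂ = Q (suc (suc (2 ℕ.* k)))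
    m = k ℕ.+ (k ℕ.+ N)
    N≤1+k+N : N ≤ suc (k ℕ.+ N)
    N≤1+k+N = ℕ.m≤n+m N (suc k)
    N≤3+m : N ≤ suc (suc (suc m))
    N≤3+m = ℕ.≤-trans (ℕ.m≤n+m N k) (ℕ.m≤n+m (k ℕ.+ N) (3 ℕ.+ k))

  -- The normalisation joins the `(q ; q)_∞` of the theorem to the `(q² ; q²)_∞` completed from
  -- `E n` and the numerator of the crank summand.
  T : ℕ → Carrier
  T k = F N * E N * sum< (suc N) (v k)

  T-recurrence : ∀ k → T k ≈ 1# - Q (suc (suc (2 ℕ.* k))) - Q (suc (suc (2 ℕ.* k))) * T (suc k)
  T-recurrence k = begin
    f * Σv                            ≈⟨ solve 4 (λ f s c t → f :* s := f :* (s :+ c :* t) :- c :* (f :* t)) refl f Σv c₂ Σv′ ⟩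
    f * (Σv + c₂ * Σv′) - c₂ * (f * Σv′)
      ≈⟨ +-congʳ (*-congˡ (+-congˡ (*-distribˡ-sum< (suc N) c₂ (v (suc k))))) ⟩
    f * (Σv + sum< (suc N) (λ r → c₂ * v (suc k) r)) - c₂ * (f * Σv′)
      ≈⟨ +-congʳ (*-congˡ (sum<-distrib-+ (suc N) (v k) _)) ⟨
    f * sum< (suc N) (λ r → v k r + c₂ * v (suc k) r) - c₂ * (f * Σv′)
      ≈⟨ +-congʳ (trans (*-congˡ (v-sum k N)) (F∞*E∞*u∞ k)) ⟩
    1# - c₂ - c₂ * (f * Σv′)          ∎
    where
    f = F N * E N
    c₂ = Q (suc (suc (2 ℕ.* k)))
    Σv = sum< (suc N) (v k)
    Σv′ = sum< (suc N) (v (suc k))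

  -- The partial theta series `τ k`, and its agreement with `T k`.

  g : ℕ → ℕ → Carrier
  g k j = sgn j * Q (j ℕ.* suc (j ℕ.+ 2 ℕ.* k))

  -- Folds a sum over m ∈ ℤ of terms depending on |m| only.
  twiceUnless0 : ℕ → Carrier → Carrier
  twiceUnless0 zero    x = x
  twiceUnless0 (suc _) x = x + x

  τ : ℕ → Carrier
  τ k = sum< (suc N) λ j → twiceUnless0 j (g k j)

  g-suc : ∀ k j → g k (suc j) ≈ - Q (suc (suc (2 ℕ.* k))) * g (suc k) j
  g-suc k j = begin
    - sgn j * Q (suc j ℕ.* suc (suc j ℕ.+ 2 ℕ.* k))   ≡⟨ ≡.cong (λ m → - sgn j * Q m) (exponent j k) ⟩
    - sgn j * Q (suc (suc (2 ℕ.* k)) ℕ.+ j ℕ.* suc (j ℕ.+ 2 ℕ.* suc k))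
                                                      ≈⟨ *-congˡ (Q-+ (suc (suc (2 ℕ.* k))) _) ⟩
    - sgn j * (Q (suc (suc (2 ℕ.* k))) * Q (j ℕ.* suc (j ℕ.+ 2 ℕ.* suc k)))
      ≈⟨ solve 3 (λ s x y → :- s :* (x :* y) := :- x :* (s :* y)) refl (sgn j) _ _ ⟩
    - Q (suc (suc (2 ℕ.* k))) * g (suc k) j           ∎
    where
    exponent : ∀ j k → suc j ℕ.* suc (suc j ℕ.+ 2 ℕ.* k) ≡ suc (suc (2 ℕ.* k)) ℕ.+ j ℕ.* suc (j ℕ.+ 2 ℕ.* suc k)
    exponent = solve-∀

  g-0 : ∀ k → g k 0 ≈ 1#
  g-0 k = trans (*-identityˡ _) Q-0

  g-≥N : ∀ k {j} → N ≤ j → g k j ≈ 0#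
  g-≥N k {j} N≤j = trans (*-congˡ (Q-≥N (ℕ.≤-trans N≤j (ℕ.m≤m*n j (suc (j ℕ.+ 2 ℕ.* k)))))) (zeroʳ _)

  -- The terms with `j > 0`, each counted twice, are `- q^(2k+2)` times the terms of `g (suc k)`.
  τ≈1-2* : ∀ k → τ k ≈ 1# - (Q (suc (suc (2 ℕ.* k))) * sum< N (g (suc k)) + Q (suc (suc (2 ℕ.* k))) * sum< N (g (suc k)))
  τ≈1-2* k = begin
    sum< (suc N) (λ j → twiceUnless0 j (g k j))             ≡⟨ sum<-head N _ ⟩
    g k 0 + sum< N (λ j → g k (suc j) + g k (suc j))        ≈⟨ +-cong (g-0 k) (sum<-distrib-+ N _ _) ⟩
    1# + (sum< N (λ j → g k (suc j)) + sum< N (λ j → g k (suc j)))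
      ≈⟨ +-congˡ (+-cong Σg Σg) ⟩
    1# + (- c₂ * sum< N (g (suc k)) + - c₂ * sum< N (g (suc k)))
      ≈⟨ solve 2 (λ c s → :1 :+ (:- c :* s :+ :- c :* s) := :1 :- (c :* s :+ c :* s)) refl c₂ _ ⟩
    1# - (c₂ * sum< N (g (suc k)) + c₂ * sum< N (g (suc k))) ∎
    where
    c₂ = Q (suc (suc (2 ℕ.* k)))
    Σg : sum< N (λ j → g k (suc j)) ≈ - c₂ * sum< N (g (suc k))
    Σg = trans (sum<-cong N λ j _ → g-suc k j) (sym (*-distribˡ-sum< N (- c₂) (g (suc k))))

  -- Doubling the whole sum counts `g k 0 = 1` once too often. Used at `k + 1`, this turns the sum
  -- in `τ≈1-2*` back into `τ (suc k)`.
  τ≈2*-1 : ∀ k → τ k ≈ sum< N (g k) + sum< N (g k) - 1#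
  τ≈2*-1 k = begin
    sum< (suc N) (λ j → twiceUnless0 j (g k j))             ≡⟨ sum<-head N _ ⟩
    g k 0 + sum< N (λ j → g k (suc j) + g k (suc j))        ≈⟨ +-congˡ (sum<-distrib-+ N _ _) ⟩
    g k 0 + (S + S)                                         ≈⟨ solve 2 (λ x s → x :+ (s :+ s) := x :+ s :+ (x :+ s) :- x) refl (g k 0) S ⟩
    g k 0 + S + (g k 0 + S) - g k 0                         ≈⟨ +-cong (+-cong Σg Σg) (-‿cong (g-0 k)) ⟩
    sum< N (g k) + sum< N (g k) - 1#                        ∎
    where
    S = sum< N (λ j → g k (suc j))
    Σg : g k 0 + S ≈ sum< N (g k)
    -- The range can end at `N` instead of `N + 1` because `g k N` is divisible by `q^N`.
    Σg = trans (reflexive (≡.sym (sum<-head N (g k)))) (trans (sum<-suc N (g k)) (trans (+-congˡ (g-≥N k ℕ.≤-refl)) (+-identityʳ _)))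

  τ-recurrence : ∀ k → τ k ≈ 1# - Q (suc (suc (2 ℕ.* k))) - Q (suc (suc (2 ℕ.* k))) * τ (suc k)
  τ-recurrence k = begin
    τ k                       ≈⟨ τ≈1-2* k ⟩
    1# - (c₂ * s + c₂ * s)    ≈⟨ solve 2 (λ c s → :1 :- (c :* s :+ c :* s) := :1 :- c :- c :* (s :+ s :- :1)) refl c₂ s ⟩
    1# - c₂ - c₂ * (s + s - 1#) ≈⟨ +-congˡ (-‿cong (*-congˡ (τ≈2*-1 (suc k)))) ⟨
    1# - c₂ - c₂ * τ (suc k)  ∎
    where
    c₂ = Q (suc (suc (2 ℕ.* k)))
    s = sum< N (g (suc k))

  -- The common recurrence expresses index `k` by index `k + 1`, so the induction runs downwards;
  -- `m` bounds the distance from `k` to `N`.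
  T≈τ : ∀ k → T k ≈ τ k
  T≈τ k = descend N k (ℕ.m≤m+n N k)
    where
    descend : ∀ m k → N ≤ m ℕ.+ k → T k ≈ τ k
    -- From `k = N` on the coefficient `q^(2k+2)` of the unknown next value is 0, so no initial
    -- value is required.
    descend zero    k N≤k   = begin
      T k                                             ≈⟨ T-recurrence k ⟩
      1# - c₂ - c₂ * T (suc k)                        ≈⟨ +-congˡ (-‿cong (*-congʳ c₂≈0)) ⟩
      1# - c₂ - 0# * T (suc k)                        ≈⟨ +-congˡ (-‿cong (trans (zeroˡ _) (sym (zeroˡ _)))) ⟩
      1# - c₂ - 0# * τ (suc k)                        ≈⟨ +-congˡ (-‿cong (*-congʳ c₂≈0)) ⟨
      1# - c₂ - c₂ * τ (suc k)                        ≈⟨ τ-recurrence k ⟨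
      τ k                                             ∎
      where
      c₂ = Q (suc (suc (2 ℕ.* k)))
      c₂≈0 : c₂ ≈ 0#
      c₂≈0 = Q-≥N (ℕ.≤-trans N≤k (ℕ.m≤n⇒m≤o+n 2 (ℕ.m≤n*m k 2)))
    descend (suc m) k N≤m+k = begin
      T k                                             ≈⟨ T-recurrence k ⟩
      1# - c₂ - c₂ * T (suc k)                        ≈⟨ +-congˡ (-‿cong (*-congˡ (descend m (suc k) (≡.subst (N ≤_) (≡.sym (ℕ.+-suc m k)) N≤m+k)))) ⟩
      1# - c₂ - c₂ * τ (suc k)                        ≈⟨ τ-recurrence k ⟨
      τ k                                             ∎
      where
      c₂ = Q (suc (suc (2 ℕ.* k)))

  -- This is the expansion at `z = 1`: the constant sequence 1 satisfies the eigenvector equations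
  -- with `ω = 2`, and the factor with `i = 0` is `1 + 1 - 2`. Such a factor is present only in a
  -- nonempty product, whence `suc n`.
  vanishing-sum : ∀ n → suc n ≤ N → E (suc n) * sum< (suc N) (e (suc n)) ≈ 0#
  vanishing-sum n n<N = begin
    E (suc n) * sum< (suc N) (e (suc n))                          ≈⟨ *-congˡ (sum<-cong (suc N) λ k _ → *-identityʳ _) ⟨
    E (suc n) * sum< (suc N) (λ k → e (suc n) k * 1#)
      ≈⟨ product-expansion {λ _ → 1#} {1# + 1#} (*-identityʳ _) (λ _ → *-identityʳ _) (suc n) n<N ⟨
    product< (suc n) f * 1#                                       ≡⟨ ≡.cong (_* 1#) (product<-head n f) ⟩
    (1# + Q 0 * Q 0 - Q 0 * (1# + 1#)) * p * 1#                   ≈⟨ *-congʳ (*-congʳ (+-cong (+-congˡ (*-cong Q-0 Q-0)) (-‿cong (*-congʳ Q-0)))) ⟩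
    (1# + 1# * 1# - 1# * (1# + 1#)) * p * 1#                      ≈⟨ solve 1 (λ p → (:1 :+ :1 :* :1 :- :1 :* (:1 :+ :1)) :* p :* :1 := :0) refl p ⟩
    0#                                                            ∎
    where
    f = λ i → 1# + Q i * Q i - Q i * (1# + 1#)
    p = product< n (f ∘ suc)

  -1^≈sgn : ∀ m → (- 1#) ^ m ≈ sgn m
  -1^≈sgn zero    = refl
  -1^≈sgn (suc m) = trans (*-congˡ (-1^≈sgn m)) (solve 1 (λ s → :- :1 :* s := :- s) refl (sgn m))

  sgn-2*+ : ∀ j m → sgn (2 ℕ.* j ℕ.+ m) ≈ sgn m
  sgn-2*+ zero    m = refl
  sgn-2*+ (suc j) m = begin
    sgn (2 ℕ.* suc j ℕ.+ m)        ≡⟨ ≡.cong (λ n → sgn (n ℕ.+ m)) (ℕ.*-suc 2 j) ⟩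
    - - sgn (2 ℕ.* j ℕ.+ m)        ≈⟨ solve 1 (λ s → :- :- s := s) refl _ ⟩
    sgn (2 ℕ.* j ℕ.+ m)            ≈⟨ sgn-2*+ j m ⟩
    sgn m                          ∎

  sgn-+ : ∀ m n → sgn (m ℕ.+ n) ≈ sgn m * sgn n
  sgn-+ zero    n = sym (*-identityˡ _)
  sgn-+ (suc m) n = trans (-‿cong (sgn-+ m n)) (solve 2 (λ x y → :- (x :* y) := :- x :* y) refl (sgn m) (sgn n))

  twiceUnless0-0 : ∀ j {x} → x ≈ 0# → twiceUnless0 j x ≈ 0#
  twiceUnless0-0 zero    x≈0 = x≈0
  twiceUnless0-0 (suc _) x≈0 = trans (+-cong x≈0 x≈0) (+-identityˡ 0#)

  -- Powers of `z`, and the exchange of the sums over `n` and `k`.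

  module _ (Z : ℤ → Carrier) (Z-0 : Z (+ 0) ≈ 1#) (Z-+ : ∀ i j → Z (i ℤ.+ j) ≈ Z i * Z j) where

    z z⁻¹ : Carrier
    z   = Z (+ 1)
    z⁻¹ = Z -[1+ 0 ]

    a b : ℕ → Carrier
    a k = Z (+ suc k) + Z (ℤ.- + k)
    b k = a k - a 0

    private
      ω*a₀ : (z + z⁻¹) * a 0 ≈ a 1 + a 0
      ω*a₀ = begin
        (z + z⁻¹) * (z + Z (+ 0))
          ≈⟨ solve 3 (λ x y u → (x :+ y) :* (x :+ u) := x :* x :+ y :* u :+ (x :* u :+ y :* x)) refl z z⁻¹ (Z (+ 0)) ⟩
        z * z + z⁻¹ * Z (+ 0) + (z * Z (+ 0) + z⁻¹ * z)
          ≈⟨ +-cong (+-cong (Z-+ (+ 1) (+ 1)) (Z-+ -[1+ 0 ] (+ 0))) (+-cong (Z-+ (+ 1) (+ 0)) (Z-+ -[1+ 0 ] (+ 1))) ⟨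
        a 1 + a 0 ∎

      ω*a₊ : ∀ k → (z + z⁻¹) * a (suc k) ≈ a (suc (suc k)) + a k
      ω*a₊ k = begin
        (z + z⁻¹) * (Z (+ suc (suc k)) + Z -[1+ k ])
          ≈⟨ solve 4 (λ x y u v → (x :+ y) :* (u :+ v) := x :* u :+ y :* v :+ (y :* u :+ x :* v)) refl z z⁻¹ _ _ ⟩
        z * Z (+ suc (suc k)) + z⁻¹ * Z -[1+ k ] + (z⁻¹ * Z (+ suc (suc k)) + z * Z -[1+ k ])
          ≈⟨ +-cong (+-cong (Z-+ (+ 1) (+ suc (suc k))) (Z-+ -[1+ 0 ] -[1+ k ])) (+-cong (Z-+ -[1+ 0 ] (+ suc (suc k))) (Z-+ (+ 1) -[1+ k ])) ⟨
        Z (+ suc (suc (suc k))) + Z -[1+ suc k ] + (Z (+ suc k) + Z (1 ℤ.⊖ suc k))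
          ≡⟨ ≡.cong (λ i → Z (+ suc (suc (suc k))) + Z -[1+ suc k ] + (Z (+ suc k) + Z i))
               (≡.trans (ℤ.[1+m]⊖[1+n]≡m⊖n 0 k) (ℤ.⊖-≤ {0} {k} z≤n)) ⟩
        a (suc (suc k)) + a k ∎

      [1+z]≈a₀ : 1# + z ≈ a 0
      [1+z]≈a₀ = trans (+-comm 1# z) (+-congˡ (sym Z-0))

      z*z⁻¹≈1 : z * z⁻¹ ≈ 1#
      z*z⁻¹≈1 = trans (sym (Z-+ (+ 1) -[1+ 0 ])) Z-0

      poch-product : ∀ n → poch z 1 n * poch z⁻¹ 1 n ≈ product< n (λ i → 1# + Q i * Q i - Q i * (z + z⁻¹))
      poch-product n = trans (sym (product<-distrib-* n _ _)) (product<-cong n λ i _ → begin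
        (1# - z * Q (1 ℕ.* i)) * (1# - z⁻¹ * Q (1 ℕ.* i))
          ≡⟨ ≡.cong (λ j → (1# - z * Q j) * (1# - z⁻¹ * Q j)) (ℕ.*-identityˡ i) ⟩
        (1# - z * Q i) * (1# - z⁻¹ * Q i)
          ≈⟨ solve 3 (λ x y q → (:1 :- x :* q) :* (:1 :- y :* q) := :1 :+ x :* y :* (q :* q) :- q :* (x :+ y)) refl z z⁻¹ (Q i) ⟩
        1# + z * z⁻¹ * (Q i * Q i) - Q i * (z + z⁻¹)
          ≈⟨ +-congʳ (+-congˡ (trans (*-congʳ z*z⁻¹≈1) (*-identityˡ _))) ⟩
        1# + Q i * Q i - Q i * (z + z⁻¹) ∎)

    poch-expansion : ∀ n → suc n ≤ N →
      (1# + z) * (poch z 1 (suc n) * poch z⁻¹ 1 (suc n)) ≈ E (suc n) * sum< (suc N) (λ k → e (suc n) k * b k)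
    poch-expansion n n<N = begin
      (1# + z) * (poch z 1 (suc n) * poch z⁻¹ 1 (suc n))          ≈⟨ *-cong [1+z]≈a₀ (poch-product (suc n)) ⟩
      a 0 * product< (suc n) (λ i → 1# + Q i * Q i - Q i * (z + z⁻¹)) ≈⟨ *-comm _ _ ⟩
      product< (suc n) (λ i → 1# + Q i * Q i - Q i * (z + z⁻¹)) * a 0 ≈⟨ product-expansion ω*a₀ ω*a₊ (suc n) n<N ⟩
      -- Each `a k` splits as `a 0 + b k`; the part with `a 0` is a multiple of the vanishing sum of
      -- the coefficients.
      E₁ * sum< (suc N) (λ k → e₁ k * a k)                        ≈⟨ *-congˡ (sum<-cong (suc N) λ k _ → solve 3 (λ e a c → e :* a := c :* e :+ e :* (a :- c)) refl (e₁ k) (a k) (a 0)) ⟩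
      E₁ * sum< (suc N) (λ k → a 0 * e₁ k + e₁ k * b k)           ≈⟨ *-congˡ (trans (sum<-distrib-+ (suc N) _ _) (+-congʳ (sym (*-distribˡ-sum< (suc N) (a 0) e₁)))) ⟩
      E₁ * (a 0 * S + S′)                                         ≈⟨ solve 4 (λ e c s t → e :* (c :* s :+ t) := c :* (e :* s) :+ e :* t) refl E₁ (a 0) S S′ ⟩
      a 0 * (E₁ * S) + E₁ * S′                                    ≈⟨ +-congʳ (trans (*-congˡ (vanishing-sum n n<N)) (zeroʳ _)) ⟩
      0# + E₁ * S′                                                ≈⟨ +-identityˡ _ ⟩
      E₁ * S′                                                     ∎
      where
      E₁ = E (suc n)
      e₁ = e (suc n)
      S = sum< (suc N) e₁
      S′ = sum< (suc N) (λ k → e₁ k * b k)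

    private
      H : ℕ → Carrier
      H n = sum< (suc N) (λ k → Q n * (e n k * b k))

      -- Since `b 0 = 0` and `e 0 k = 0` for `k > 0`, the crank sum, which starts at `n = 1`, may be
      -- started at 0. Every column `k` then begins at `n = k` without an exception for `k = 0`.
      H-0 : H 0 ≈ 0#
      H-0 = sum<-0 (suc N) λ where
        zero    _ → trans (*-congˡ (trans (*-congˡ (-‿inverseʳ (a 0))) (zeroʳ _))) (zeroʳ _)
        (suc k) _ → trans (*-congˡ (trans (*-congʳ (e-< (s≤s z≤n))) (zeroˡ _))) (zeroʳ _)

      column-sum : ∀ k → F N * E N * sum< (suc N) (λ n → Q n * (e n k * b k)) ≈ b k * (sgn k * Q (tri (suc k)) * τ k)
      column-sum k = begin
        F N * E N * sum< (suc N) (λ n → Q n * (e n k * b k))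
          -- The substitution `n = k + r`: coefficients with `n < k` vanish, and so does `q^n` for
          -- `n > N`.
          ≈⟨ *-congˡ (sum<-shift k (suc N) _
               (λ n n<k → trans (*-congˡ (trans (*-congʳ (e-< n<k)) (zeroˡ _))) (zeroʳ _))
               (λ n N<n → trans (*-congʳ (Q-≥N (ℕ.<⇒≤ N<n))) (zeroˡ _))) ⟩
        F N * E N * sum< (suc N) (λ r → Q (k ℕ.+ r) * (e (k ℕ.+ r) k * b k))
          ≈⟨ *-congˡ (sum<-cong (suc N) λ r _ → begin
               Q (k ℕ.+ r) * (s * (Q (tri k) * w (k ℕ.+ r) k) * b k)   ≈⟨ *-congʳ (Q-+ k r) ⟩
               Q k * Q r * (s * (Q (tri k) * w (k ℕ.+ r) k) * b k)
                 ≈⟨ solve 6 (λ x y s t w b → x :* y :* (s :* (t :* w) :* b) := b :* (s :* (t :* x)) :* (y :* w)) refl (Q k) (Q r) s (Q (tri k)) _ (b k) ⟩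
               b k * (s * (Q (tri k) * Q k)) * v k r                   ≈⟨ *-congʳ (*-congˡ (*-congˡ (Q-+ (tri k) k))) ⟨
               b k * (s * Q (tri (suc k))) * v k r                     ∎) ⟩
        F N * E N * sum< (suc N) (λ r → b k * (s * Q (tri (suc k))) * v k r)
          ≈⟨ *-congˡ (*-distribˡ-sum< (suc N) _ (v k)) ⟨
        F N * E N * (b k * (s * Q (tri (suc k))) * sum< (suc N) (v k))
          ≈⟨ solve 4 (λ f b s t → f :* (b :* s :* t) := b :* (s :* (f :* t))) refl (F N * E N) (b k) (s * Q (tri (suc k))) _ ⟩
        b k * (s * Q (tri (suc k)) * T k)                              ≈⟨ *-congˡ (*-congˡ (T≈τ k)) ⟩
        b k * (s * Q (tri (suc k)) * τ k)                              ∎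
        where
        s = sgn k

    -- The summand of the theorem for n = 2j + k and |m| = j.
    hecke : ℕ → ℕ → Carrier
    hecke k j = sgn k * sgn j * b k * Q (tri (suc k) ℕ.+ j ℕ.* suc (j ℕ.+ 2 ℕ.* k))

    hecke-≥N : ∀ k j → N ≤ 2 ℕ.* j ℕ.+ k → hecke k j ≈ 0#
    hecke-≥N k j N≤2j+k = trans (*-congˡ (Q-≥N (ℕ.≤-trans N≤2j+k (exponent-≥ k j)))) (zeroʳ _)

    private
      hecke-sum : ∀ k → b k * (sgn k * Q (tri (suc k)) * τ k) ≈ sum< (suc N) (λ j → twiceUnless0 j (hecke k j))
      hecke-sum k = begin
        b k * (s * t * τ k)                                            ≈⟨ *-assoc _ _ _ ⟨
        b k * (s * t) * τ k                                            ≈⟨ *-distribˡ-sum< (suc N) _ _ ⟩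
        sum< (suc N) (λ j → b k * (s * t) * twiceUnless0 j (g k j))    ≈⟨ sum<-cong (suc N) (λ j _ → pull j) ⟩
        sum< (suc N) (λ j → twiceUnless0 j (hecke k j))                ∎
        where
        s = sgn k
        t = Q (tri (suc k))
        hecke≈ : ∀ j → b k * (s * t) * g k j ≈ hecke k j
        hecke≈ j = begin
          b k * (s * t) * (sgn j * Q (j ℕ.* suc (j ℕ.+ 2 ℕ.* k)))
            ≈⟨ solve 5 (λ b s t u x → b :* (s :* t) :* (u :* x) := s :* u :* b :* (t :* x)) refl (b k) s t (sgn j) _ ⟩
          s * sgn j * b k * (t * Q (j ℕ.* suc (j ℕ.+ 2 ℕ.* k)))        ≈⟨ *-congˡ (Q-+ (tri (suc k)) _) ⟨
          hecke k j                                                    ∎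
        pull : ∀ j → b k * (s * t) * twiceUnless0 j (g k j) ≈ twiceUnless0 j (hecke k j)
        pull zero    = hecke≈ 0
        pull (suc j) = trans (distribˡ _ _ _) (+-cong (hecke≈ (suc j)) (hecke≈ (suc j)))

    -- The reciprocals of the denominators enter only through the property of being inverses, so the
    -- argument is independent of how division of series is defined.
    spt-expansion :
      (ρ : ℕ → Carrier) →
      (∀ n → poch (z * Q (suc n)) 1 N * poch (z⁻¹ * Q (suc n)) 1 N * ρ (suc n) ≈ 1#) →
      (1# + z) * poch z 1 N * poch z⁻¹ 1 N * F N
        * sum< N (λ n → Q (suc n) * poch (Q (2 ℕ.* suc n ℕ.+ 2)) 2 N * ρ (suc n))
      ≈ sum< (suc N) (λ k → sum< (suc N) λ j → twiceUnless0 j (hecke k j))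
    spt-expansion ρ ρ-inverse = begin
      κ * sum< N (λ n → Q (suc n) * tail (suc n) * ρ (suc n))       ≈⟨ *-distribˡ-sum< N κ _ ⟩
      sum< N (λ n → κ * (Q (suc n) * tail (suc n) * ρ (suc n)))     ≈⟨ sum<-cong N row ⟩
      sum< N (λ n → F N * E N * H (suc n))                          ≈⟨ *-distribˡ-sum< N (F N * E N) _ ⟨
      F N * E N * sum< N (H ∘ suc)                                  ≈⟨ *-congˡ (trans (+-congʳ H-0) (+-identityˡ _)) ⟨
      F N * E N * (H 0 + sum< N (H ∘ suc))                          ≡⟨ ≡.cong (F N * E N *_) (sum<-head N H) ⟨
      F N * E N * sum< (suc N) H                                    ≈⟨ *-congˡ (sum<-comm (suc N) (suc N) _) ⟩
      F N * E N * sum< (suc N) (λ k → sum< (suc N) λ n → Q n * (e n k * b k))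
                                                                    ≈⟨ *-distribˡ-sum< (suc N) (F N * E N) _ ⟩
      sum< (suc N) (λ k → F N * E N * sum< (suc N) (λ n → Q n * (e n k * b k)))
        ≈⟨ sum<-cong (suc N) (λ k _ → trans (column-sum k) (hecke-sum k)) ⟩
      sum< (suc N) (λ k → sum< (suc N) λ j → twiceUnless0 j (hecke k j)) ∎
      where
      κ = (1# + z) * poch z 1 N * poch z⁻¹ 1 N * F N
      tail : ℕ → Carrier
      tail n = poch (Q (2 ℕ.* n ℕ.+ 2)) 2 N
      1*≡ : ∀ x n → poch (x * Q (1 ℕ.* n)) 1 N ≈ poch (x * Q n) 1 N
      1*≡ x n = reflexive (≡.cong (λ m → poch (x * Q m) 1 N) (ℕ.*-identityˡ n))
      row : ∀ n → n < N → κ * (Q (suc n) * tail (suc n) * ρ (suc n)) ≈ F N * E N * H (suc n)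
      row n n<N = begin
        (1# + z) * poch z 1 N * poch z⁻¹ 1 N * F N * (Qm * tail m * ρ m)
          -- Both infinite products are cut at `m`; their tails form the denominator, which `ρ m`
          -- cancels.
          ≈⟨ *-congʳ (*-congʳ (*-cong (*-congˡ (trans (poch-tail z 1 m) (*-congˡ (1*≡ z m)))) (trans (poch-tail z⁻¹ 1 m) (*-congˡ (1*≡ z⁻¹ m))))) ⟩
        (1# + z) * (poch z 1 m * p) * (poch z⁻¹ 1 m * p′) * F N * (Qm * tail m * ρ m)
          ≈⟨ solve 9 (λ u x p y p′ f q t r → u :* (x :* p) :* (y :* p′) :* f :* (q :* t :* r)
                       := f :* t :* (q :* (u :* (x :* y))) :* (p :* p′ :* r))
               refl (1# + z) (poch z 1 m) p (poch z⁻¹ 1 m) p′ (F N) Qm (tail m) (ρ m) ⟩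
        F N * tail m * (Qm * ((1# + z) * (poch z 1 m * poch z⁻¹ 1 m))) * (p * p′ * ρ m)
          ≈⟨ *-cong (*-congˡ (*-congˡ (poch-expansion n n<N))) (ρ-inverse n) ⟩
        F N * tail m * (Qm * (E m * S)) * 1#
          ≈⟨ solve 5 (λ f t q e s → f :* t :* (q :* (e :* s)) :* :1 := f :* (e :* t) :* (q :* s)) refl (F N) (tail m) Qm (E m) S ⟩
        F N * (E m * tail m) * (Qm * S)
          -- `(q² ; q²)_m (q^(2m+2) ; q²)_∞` is `(q² ; q²)_∞` for every `m`, so this factor leaves
          -- the sum over `n`.
          ≈⟨ *-cong (*-congˡ (trans (poch-tail (Q 2) 2 m) (*-congˡ (poch-cong 2 N tail-base)))) (sym (*-distribˡ-sum< (suc N) Qm _)) ⟨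
        F N * E N * H m ∎
        where
        m = suc n
        Qm = Q m
        p = poch (z * Q m) 1 N
        p′ = poch (z⁻¹ * Q m) 1 N
        S = sum< (suc N) (λ k → e m k * b k)
        tail-base : Q 2 * Q (2 ℕ.* m) ≈ Q (2 ℕ.* m ℕ.+ 2)
        tail-base = trans (*-comm _ _) (sym (Q-+ (2 ℕ.* m) 2))

    hecke-half-sum :
      sum< (suc N) (λ n → sum< (suc (n / 2)) λ j → twiceUnless0 j (hecke (n ℕ.∸ 2 ℕ.* j) j))
      ≈ sum< (suc N) (λ k → sum< (suc N) λ j → twiceUnless0 j (hecke k j))
    hecke-half-sum = sum<-half (suc N) (λ k j → twiceUnless0 j (hecke k j)) λ k j N<2j+k →
      twiceUnless0-0 j (hecke-≥N k j (ℕ.<⇒≤ N<2j+k))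

    hecke-half-sum-≥N : ∀ n → N ≤ n → sum< (suc (n / 2)) (λ j → twiceUnless0 j (hecke (n ℕ.∸ 2 ℕ.* j) j)) ≈ 0#
    hecke-half-sum-≥N n N≤n = sum<-0 (suc (n / 2)) λ j j≤n/2 → twiceUnless0-0 j (hecke-≥N (n ℕ.∸ 2 ℕ.* j) j
      (≡.subst (N ≤_) (≡.sym (ℕ.m+[n∸m]≡n (≤n/2⇒2*≤n (ℕ.≤-pred j≤n/2)))) N≤n))

    factored-b : ∀ k → (1# - Z (+ suc k)) * (1# - Z (+ k)) * Z (ℤ.- + k) ≈ b k
    factored-b k = begin
      (1# - Z (+ suc k)) * (1# - x) * y    ≈⟨ *-congʳ (*-congʳ (1-‿cong (Z-+ (+ 1) (+ k)))) ⟩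
      (1# - z * x) * (1# - x) * y
        ≈⟨ solve 3 (λ z x y → (:1 :- z :* x) :* (:1 :- x) :* y := z :* x :* (x :* y) :+ y :- (z :* (x :* y) :+ x :* y)) refl z x y ⟩
      z * x * (x * y) + y - (z * (x * y) + x * y)
        ≈⟨ +-cong (+-congʳ (*-congˡ x*y≈1)) (-‿cong (+-cong (*-congˡ x*y≈1) x*y≈1)) ⟩
      z * x * 1# + y - (z * 1# + 1#)
        ≈⟨ +-cong (+-congʳ (trans (*-identityʳ _) (sym (Z-+ (+ 1) (+ k))))) (-‿cong (+-cong (*-identityʳ _) (sym Z-0))) ⟩
      b k                                  ∎
      where
      x = Z (+ k)
      y = Z (ℤ.- + k)
      x*y≈1 : x * y ≈ 1#
      x*y≈1 = trans (sym (Z-+ (+ k) (ℤ.- + k))) (trans (reflexive (≡.cong Z (ℤ.+-inverseʳ (+ k)))) Z-0)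

    factored-hecke : ∀ k j s → s ≈ sgn k * sgn j →
      s * (1# - Z (+ suc k)) * (1# - Z (+ k)) * Z (ℤ.- + k) * Q (tri (suc k) ℕ.+ j ℕ.* suc (j ℕ.+ 2 ℕ.* k)) ≈ hecke k j
    factored-hecke k j s s≈ = *-congʳ (trans (solve 4 (λ s x y z → s :* x :* y :* z := s :* (x :* y :* z)) refl _ _ _ _)
      (*-cong s≈ (factored-b k)))

-- Laurent polynomials form a commutative ring.

module LaurentPolynomials where

  open RawRing laurent
  open ≡-Reasoning

  private
    δ : ℤ → ℤ → ℤ → ℤ
    δ c i j = if does (i ℤ.≟ j) then c else ℤ.0ℤ

    δ-≡ : ∀ c {i j} → i ≡ j → δ c i j ≡ c
    δ-≡ c {i} {j} i≡j = ≡.cong (λ b → if b then c else ℤ.0ℤ) (dec-true (i ℤ.≟ j) i≡j)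

    δ-⇔ : ∀ c i j i′ j′ → (i ≡ j → i′ ≡ j′) → (i′ ≡ j′ → i ≡ j) → δ c i j ≡ δ c i′ j′
    δ-⇔ c i j i′ j′ to from with i ℤ.≟ j
    ... | yes i≡j = ≡.sym (δ-≡ c (to i≡j))
    ... | no  i≢j = ≡.sym (≡.cong (λ b → if b then c else ℤ.0ℤ) (dec-false (i′ ℤ.≟ j′) λ i′≡j′ → i≢j (from i′≡j′)))

    *-δ : ∀ c d i j → c ℤ.* δ d i j ≡ δ (c ℤ.* d) i j
    *-δ c d i j with does (i ℤ.≟ j)
    ... | true  = ≡.refl
    ... | false = ℤ.*-zeroʳ c

    +-to : ∀ i j {k} → i ℤ.+ j ≡ k → j ≡ k ℤ.- i
    +-to i j ≡.refl = cancel i j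
      where
      cancel : ∀ i j → j ≡ i ℤ.+ j ℤ.- i
      cancel = ℤ-solve-∀

    +-from : ∀ i k {j} → j ≡ k ℤ.- i → i ℤ.+ j ≡ k
    +-from i k ≡.refl = cancel i k
      where
      cancel : ∀ i k → i ℤ.+ (k ℤ.- i) ≡ k
      cancel = ℤ-solve-∀

  coeff-+ : ∀ p r i → coeffᶻ (p + r) i ≡ coeffᶻ p i ℤ.+ coeffᶻ r i
  coeff-+ []            r i = ≡.sym (ℤ.+-identityˡ _)
  coeff-+ ((e , c) ∷ p) r i = ≡.trans (≡.cong (ℤ._+_ (δ c e i)) (coeff-+ p r i)) (≡.sym (ℤ.+-assoc (δ c e i) _ _))

  coeff-neg : ∀ p i → coeffᶻ (- p) i ≡ ℤ.- coeffᶻ p i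
  coeff-neg []            i = ≡.refl
  coeff-neg ((e , c) ∷ p) i = begin
    δ (ℤ.- c) e i ℤ.+ coeffᶻ (- p) i       ≡⟨ ≡.cong₂ ℤ._+_ (neg-δ c e i) (coeff-neg p i) ⟩
    ℤ.- δ c e i ℤ.+ ℤ.- coeffᶻ p i         ≡⟨ ℤ.neg-distrib-+ (δ c e i) _ ⟨
    ℤ.- (δ c e i ℤ.+ coeffᶻ p i)           ∎
    where
    neg-δ : ∀ c i j → δ (ℤ.- c) i j ≡ ℤ.- δ c i j
    neg-δ c i j with does (i ℤ.≟ j)
    ... | true  = ≡.refl
    ... | false = ≡.refl

  scale : ℤ Product.× ℤ → Laurent → Laurent
  scale (e , c) = List.map λ (e′ , c′) → e ℤ.+ e′ , c ℤ.* c′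

  coeff-scale : ∀ e c r i → coeffᶻ (scale (e , c) r) i ≡ c ℤ.* coeffᶻ r (i ℤ.- e)
  coeff-scale e c []              i = ≡.sym (ℤ.*-zeroʳ c)
  coeff-scale e c ((e′ , c′) ∷ r) i = begin
    δ (c ℤ.* c′) (e ℤ.+ e′) i ℤ.+ coeffᶻ (scale (e , c) r) i
      ≡⟨ ≡.cong₂ ℤ._+_ (≡.trans (δ-⇔ (c ℤ.* c′) (e ℤ.+ e′) i e′ (i ℤ.- e) (+-to e e′) (+-from e i)) (≡.sym (*-δ c c′ e′ _))) (coeff-scale e c r i) ⟩
    c ℤ.* δ c′ e′ (i ℤ.- e) ℤ.+ c ℤ.* coeffᶻ r (i ℤ.- e)
      ≡⟨ ℤ.*-distribˡ-+ c _ _ ⟨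
    c ℤ.* (δ c′ e′ (i ℤ.- e) ℤ.+ coeffᶻ r (i ℤ.- e)) ∎

  coeff-∷* : ∀ e c p r i → coeffᶻ (((e , c) ∷ p) * r) i ≡ c ℤ.* coeffᶻ r (i ℤ.- e) ℤ.+ coeffᶻ (p * r) i
  coeff-∷* e c p r i = ≡.trans (coeff-+ (scale (e , c) r) (p * r) i) (≡.cong (ℤ._+ _) (coeff-scale e c r i))

  -- Induction on the list `p` is available because only the other factor changes. Equal polynomials
  -- may be lists of different shapes, so congruence in the left factor has to come from
  -- commutativity.
  *-congˡ : ∀ p {r s} → r ≈ s → p * r ≈ p * s
  *-congˡ []            r≈s i = ≡.refl
  *-congˡ ((e , c) ∷ p) {r} {s} r≈s i = begin
    coeffᶻ (((e , c) ∷ p) * r) i                     ≡⟨ coeff-∷* e c p r i ⟩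
    c ℤ.* coeffᶻ r (i ℤ.- e) ℤ.+ coeffᶻ (p * r) i    ≡⟨ ≡.cong₂ (λ x y → c ℤ.* x ℤ.+ y) (r≈s (i ℤ.- e)) (*-congˡ p {r} {s} r≈s i) ⟩
    c ℤ.* coeffᶻ s (i ℤ.- e) ℤ.+ coeffᶻ (p * s) i    ≡⟨ coeff-∷* e c p s i ⟨
    coeffᶻ (((e , c) ∷ p) * s) i                     ∎

  coeff-*[] : ∀ p i → coeffᶻ (p * []) i ≡ ℤ.0ℤ
  coeff-*[] []      i = ≡.refl
  coeff-*[] (x ∷ p) i = coeff-*[] p i

  -- Multiplication recurses on its left factor. This is the mirror image of `coeff-∷*`, and the two
  -- together give commutativity by induction.
  coeff-*∷ : ∀ p e c r i → coeffᶻ (p * ((e , c) ∷ r)) i ≡ c ℤ.* coeffᶻ p (i ℤ.- e) ℤ.+ coeffᶻ (p * r) i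
  coeff-*∷ []              e c r i = ≡.sym (≡.trans (ℤ.+-identityʳ _) (ℤ.*-zeroʳ c))
  coeff-*∷ ((e′ , c′) ∷ p) e c r i = begin
    coeffᶻ (((e′ , c′) ∷ p) * ((e , c) ∷ r)) i
      ≡⟨ coeff-∷* e′ c′ p _ i ⟩
    c′ ℤ.* (δ c e (i ℤ.- e′) ℤ.+ coeffᶻ r (i ℤ.- e′)) ℤ.+ coeffᶻ (p * ((e , c) ∷ r)) i
      ≡⟨ ≡.cong₂ ℤ._+_ (ℤ.*-distribˡ-+ c′ _ _) (coeff-*∷ p e c r i) ⟩
    c′ ℤ.* δ c e (i ℤ.- e′) ℤ.+ c′ ℤ.* coeffᶻ r (i ℤ.- e′) ℤ.+ (c ℤ.* coeffᶻ p (i ℤ.- e) ℤ.+ coeffᶻ (p * r) i)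
      ≡⟨ ≡.cong (λ x → x ℤ.+ c′ ℤ.* coeffᶻ r (i ℤ.- e′) ℤ.+ (c ℤ.* coeffᶻ p (i ℤ.- e) ℤ.+ coeffᶻ (p * r) i)) swap-δ ⟩
    c ℤ.* δ c′ e′ (i ℤ.- e) ℤ.+ c′ ℤ.* coeffᶻ r (i ℤ.- e′) ℤ.+ (c ℤ.* coeffᶻ p (i ℤ.- e) ℤ.+ coeffᶻ (p * r) i)
      ≡⟨ rearrange c (δ c′ e′ (i ℤ.- e)) (c′ ℤ.* coeffᶻ r (i ℤ.- e′)) (coeffᶻ p (i ℤ.- e)) (coeffᶻ (p * r) i) ⟩
    c ℤ.* (δ c′ e′ (i ℤ.- e) ℤ.+ coeffᶻ p (i ℤ.- e)) ℤ.+ (c′ ℤ.* coeffᶻ r (i ℤ.- e′) ℤ.+ coeffᶻ (p * r) i)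
      ≡⟨ ≡.cong (ℤ._+_ (c ℤ.* _)) (coeff-∷* e′ c′ p r i) ⟨
    c ℤ.* coeffᶻ ((e′ , c′) ∷ p) (i ℤ.- e) ℤ.+ coeffᶻ (((e′ , c′) ∷ p) * r) i ∎
    where
    rearrange : ∀ c x y z w → c ℤ.* x ℤ.+ y ℤ.+ (c ℤ.* z ℤ.+ w) ≡ c ℤ.* (x ℤ.+ z) ℤ.+ (y ℤ.+ w)
    rearrange = ℤ-solve-∀
    swap-δ : c′ ℤ.* δ c e (i ℤ.- e′) ≡ c ℤ.* δ c′ e′ (i ℤ.- e)
    swap-δ = begin
      c′ ℤ.* δ c e (i ℤ.- e′)    ≡⟨ *-δ c′ c e _ ⟩
      δ (c′ ℤ.* c) e (i ℤ.- e′)  ≡⟨ ≡.cong (λ d → δ d e (i ℤ.- e′)) (ℤ.*-comm c′ c) ⟩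
      δ (c ℤ.* c′) e (i ℤ.- e′)
        ≡⟨ δ-⇔ (c ℤ.* c′) e (i ℤ.- e′) e′ (i ℤ.- e)
              (λ eq → +-to e e′ (≡.trans (ℤ.+-comm e e′) (+-from e′ i eq)))
              (λ eq → +-to e′ e (≡.trans (ℤ.+-comm e′ e) (+-from e i eq))) ⟩
      δ (c ℤ.* c′) e′ (i ℤ.- e)  ≡⟨ *-δ c c′ e′ _ ⟨
      c ℤ.* δ c′ e′ (i ℤ.- e)    ∎

  *-comm : ∀ p r → p * r ≈ r * p
  *-comm []            r i = ≡.sym (coeff-*[] r i)
  *-comm ((e , c) ∷ p) r i = begin
    coeffᶻ (((e , c) ∷ p) * r) i                     ≡⟨ coeff-∷* e c p r i ⟩
    c ℤ.* coeffᶻ r (i ℤ.- e) ℤ.+ coeffᶻ (p * r) i    ≡⟨ ≡.cong (ℤ._+_ (c ℤ.* coeffᶻ r (i ℤ.- e))) (*-comm p r i) ⟩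
    c ℤ.* coeffᶻ r (i ℤ.- e) ℤ.+ coeffᶻ (r * p) i    ≡⟨ coeff-*∷ r e c p i ⟨
    coeffᶻ (r * ((e , c) ∷ p)) i                     ∎

  *-cong : ∀ {p p′ r r′} → p ≈ p′ → r ≈ r′ → p * r ≈ p′ * r′
  *-cong {p} {p′} {r} {r′} p≈p′ r≈r′ i = begin
    coeffᶻ (p * r) i     ≡⟨ *-congˡ p {r} {r′} r≈r′ i ⟩
    coeffᶻ (p * r′) i    ≡⟨ *-comm p r′ i ⟩
    coeffᶻ (r′ * p) i    ≡⟨ *-congˡ r′ {p} {p′} p≈p′ i ⟩
    coeffᶻ (r′ * p′) i   ≡⟨ *-comm r′ p′ i ⟩
    coeffᶻ (p′ * r′) i   ∎

  *-distribʳ : ∀ s p r → (p + r) * s ≈ p * s + r * s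
  *-distribʳ s []            r i = ≡.refl
  *-distribʳ s ((e , c) ∷ p) r i = begin
    coeffᶻ (((e , c) ∷ p + r) * s) i                           ≡⟨ coeff-∷* e c (p + r) s i ⟩
    c ℤ.* coeffᶻ s (i ℤ.- e) ℤ.+ coeffᶻ ((p + r) * s) i        ≡⟨ ≡.cong (ℤ._+_ (c ℤ.* coeffᶻ s (i ℤ.- e))) (≡.trans (*-distribʳ s p r i) (coeff-+ (p * s) (r * s) i)) ⟩
    c ℤ.* coeffᶻ s (i ℤ.- e) ℤ.+ (coeffᶻ (p * s) i ℤ.+ coeffᶻ (r * s) i)  ≡⟨ ℤ.+-assoc (c ℤ.* coeffᶻ s (i ℤ.- e)) _ _ ⟨
    c ℤ.* coeffᶻ s (i ℤ.- e) ℤ.+ coeffᶻ (p * s) i ℤ.+ coeffᶻ (r * s) i    ≡⟨ ≡.cong (ℤ._+ coeffᶻ (r * s) i) (coeff-∷* e c p s i) ⟨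
    coeffᶻ (((e , c) ∷ p) * s) i ℤ.+ coeffᶻ (r * s) i          ≡⟨ coeff-+ (((e , c) ∷ p) * s) (r * s) i ⟨
    coeffᶻ (((e , c) ∷ p) * s + r * s) i                       ∎

  *-distribˡ : ∀ s p r → s * (p + r) ≈ s * p + s * r
  *-distribˡ s p r i = begin
    coeffᶻ (s * (p + r)) i                        ≡⟨ *-comm s (p + r) i ⟩
    coeffᶻ ((p + r) * s) i                        ≡⟨ *-distribʳ s p r i ⟩
    coeffᶻ (p * s + r * s) i                      ≡⟨ coeff-+ (p * s) (r * s) i ⟩
    coeffᶻ (p * s) i ℤ.+ coeffᶻ (r * s) i         ≡⟨ ≡.cong₂ ℤ._+_ (*-comm p s i) (*-comm r s i) ⟩
    coeffᶻ (s * p) i ℤ.+ coeffᶻ (s * r) i         ≡⟨ coeff-+ (s * p) (s * r) i ⟨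
    coeffᶻ (s * p + s * r) i                      ∎

  coeff-scale-* : ∀ e c r s i → coeffᶻ (scale (e , c) r * s) i ≡ c ℤ.* coeffᶻ (r * s) (i ℤ.- e)
  coeff-scale-* e c []              s i = ≡.sym (ℤ.*-zeroʳ c)
  coeff-scale-* e c ((e′ , c′) ∷ r) s i = begin
    coeffᶻ (scale (e , c) ((e′ , c′) ∷ r) * s) i
      ≡⟨ coeff-∷* (e ℤ.+ e′) (c ℤ.* c′) (scale (e , c) r) s i ⟩
    c ℤ.* c′ ℤ.* coeffᶻ s (i ℤ.- (e ℤ.+ e′)) ℤ.+ coeffᶻ (scale (e , c) r * s) i
      ≡⟨ ≡.cong₂ (λ j x → c ℤ.* c′ ℤ.* coeffᶻ s j ℤ.+ x) (sub-+ i e e′) (coeff-scale-* e c r s i) ⟩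
    c ℤ.* c′ ℤ.* coeffᶻ s (i ℤ.- e ℤ.- e′) ℤ.+ c ℤ.* coeffᶻ (r * s) (i ℤ.- e)
      ≡⟨ factor c c′ _ _ ⟩
    c ℤ.* (c′ ℤ.* coeffᶻ s (i ℤ.- e ℤ.- e′) ℤ.+ coeffᶻ (r * s) (i ℤ.- e))
      ≡⟨ ≡.cong (c ℤ.*_) (coeff-∷* e′ c′ r s (i ℤ.- e)) ⟨
    c ℤ.* coeffᶻ (((e′ , c′) ∷ r) * s) (i ℤ.- e) ∎
    where
    sub-+ : ∀ i e f → i ℤ.- (e ℤ.+ f) ≡ i ℤ.- e ℤ.- f
    sub-+ = ℤ-solve-∀
    factor : ∀ c d x y → c ℤ.* d ℤ.* x ℤ.+ c ℤ.* y ≡ c ℤ.* (d ℤ.* x ℤ.+ y)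
    factor = ℤ-solve-∀

  *-assoc : ∀ p r s → (p * r) * s ≈ p * (r * s)
  *-assoc []            r s i = ≡.refl
  *-assoc ((e , c) ∷ p) r s i = begin
    coeffᶻ ((scale (e , c) r + p * r) * s) i                             ≡⟨ *-distribʳ s (scale (e , c) r) (p * r) i ⟩
    coeffᶻ (scale (e , c) r * s + p * r * s) i                           ≡⟨ coeff-+ (scale (e , c) r * s) (p * r * s) i ⟩
    coeffᶻ (scale (e , c) r * s) i ℤ.+ coeffᶻ (p * r * s) i              ≡⟨ ≡.cong₂ ℤ._+_ (coeff-scale-* e c r s i) (*-assoc p r s i) ⟩
    c ℤ.* coeffᶻ (r * s) (i ℤ.- e) ℤ.+ coeffᶻ (p * (r * s)) i            ≡⟨ coeff-∷* e c p (r * s) i ⟨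
    coeffᶻ (((e , c) ∷ p) * (r * s)) i                                   ∎

  *-identityˡ : ∀ p → 1# * p ≈ p
  *-identityˡ p i = begin
    coeffᶻ (1# * p) i                            ≡⟨ coeff-∷* ℤ.0ℤ ℤ.1ℤ [] p i ⟩
    ℤ.1ℤ ℤ.* coeffᶻ p (i ℤ.- ℤ.0ℤ) ℤ.+ ℤ.0ℤ      ≡⟨ ≡.trans (ℤ.+-identityʳ _) (ℤ.*-identityˡ _) ⟩
    coeffᶻ p (i ℤ.- ℤ.0ℤ)                        ≡⟨ ≡.cong (coeffᶻ p) (ℤ.+-identityʳ i) ⟩
    coeffᶻ p i                                   ∎

  +-cong : ∀ {p p′ r r′} → p ≈ p′ → r ≈ r′ → p + r ≈ p′ + r′
  +-cong {p} {p′} {r} {r′} p≈p′ r≈r′ i = begin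
    coeffᶻ (p + r) i                  ≡⟨ coeff-+ p r i ⟩
    coeffᶻ p i ℤ.+ coeffᶻ r i         ≡⟨ ≡.cong₂ ℤ._+_ (p≈p′ i) (r≈r′ i) ⟩
    coeffᶻ p′ i ℤ.+ coeffᶻ r′ i       ≡⟨ coeff-+ p′ r′ i ⟨
    coeffᶻ (p′ + r′) i                ∎

  +-comm : ∀ p r → p + r ≈ r + p
  +-comm p r i = begin
    coeffᶻ (p + r) i                  ≡⟨ coeff-+ p r i ⟩
    coeffᶻ p i ℤ.+ coeffᶻ r i         ≡⟨ ℤ.+-comm (coeffᶻ p i) _ ⟩
    coeffᶻ r i ℤ.+ coeffᶻ p i         ≡⟨ coeff-+ r p i ⟨
    coeffᶻ (r + p) i                  ∎

  -‿inverseˡ : ∀ p → - p + p ≈ 0#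
  -‿inverseˡ p i = begin
    coeffᶻ (- p + p) i                ≡⟨ coeff-+ (- p) p i ⟩
    coeffᶻ (- p) i ℤ.+ coeffᶻ p i     ≡⟨ ≡.cong (ℤ._+ coeffᶻ p i) (coeff-neg p i) ⟩
    ℤ.- coeffᶻ p i ℤ.+ coeffᶻ p i     ≡⟨ ℤ.+-inverseˡ (coeffᶻ p i) ⟩
    ℤ.0ℤ                              ∎

  laurentRing : CommutativeRing 0ℓ 0ℓ
  laurentRing = record
    { Carrier = Laurent
    ; _≈_ = _≈_
    ; _+_ = _+_
    ; _*_ = _*_
    ; -_ = -_
    ; 0# = 0#
    ; 1# = 1#
    ; isCommutativeRing = record
      { isRing = record
        { +-isAbelianGroup = record
          { isGroup = record
            { isMonoid = record
              { isSemigroup = record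
                { isMagma = record
                  { isEquivalence = record
                    { refl  = λ i → ≡.refl
                    ; sym   = λ p≈r i → ≡.sym (p≈r i)
                    ; trans = λ p≈r r≈s i → ≡.trans (p≈r i) (r≈s i)
                    }
                  ; ∙-cong = λ {p} {p′} {r} {r′} → +-cong {p} {p′} {r} {r′}
                  }
                ; assoc = λ p r s i → ≡.cong (λ t → coeffᶻ t i) (++-assoc p r s)
                }
              ; identity = (λ p i → ≡.refl) , (λ p i → ≡.cong (λ t → coeffᶻ t i) (++-identityʳ p))
              }
            ; inverse = -‿inverseˡ , (λ p i → ≡.trans (+-comm p (- p) i) (-‿inverseˡ p i))
            ; ⁻¹-cong = λ {p} {r} p≈r i → ≡.trans (coeff-neg p i) (≡.trans (≡.cong ℤ.-_ (p≈r i)) (≡.sym (coeff-neg r i)))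
            }
          ; comm = +-comm
          }
        ; *-cong = λ {p} {p′} {r} {r′} → *-cong {p} {p′} {r} {r′}
        ; *-assoc = *-assoc
        ; *-identity = *-identityˡ , (λ p i → ≡.trans (*-comm p 1# i) (*-identityˡ p i))
        ; distrib = *-distribˡ , *-distribʳ
        }
      ; *-comm = *-comm
      }
    }

-- Power series modulo `q^N`, and the passage from infinite sums and products to finite ones.

module TruncatedPowerSeries {c ℓ} (K : CommutativeRing c ℓ) where

  private module K where
    open CommutativeRing K public
    open IntegerSolver K public
    open SetoidReasoning setoid public
  open PowerSeries (Ring.rawRing K.ring)

  infix 4 _≈[_]_
  _≈[_]_ : Carrier → ℕ → Carrier → Set ℓ
  f ≈[ N ] g = ∀ n → n < N → f n K.≈ g n

  infixr 8 _·_
  _·_ : K.Carrier → Carrier → Carrier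
  (a · f) n = a K.* f n

  private
    -- A coefficient of a product depends only on coefficients of the same or lower index; hence
    -- multiplication respects equality modulo `q^N`.
    *-cong-≤ : ∀ n {f f′ g g′} → (∀ i → i ≤ n → f i K.≈ f′ i) → (∀ i → i ≤ n → g i K.≈ g′ i) →
               (f * g) n K.≈ (f′ * g′) n
    *-cong-≤ zero    f≈f′ g≈g′ = K.+-congʳ (K.*-cong (f≈f′ 0 z≤n) (g≈g′ 0 z≤n))
    *-cong-≤ (suc n) f≈f′ g≈g′ = K.+-cong (K.*-cong (f≈f′ 0 z≤n) (g≈g′ (suc n) ℕ.≤-refl))
      (*-cong-≤ n (λ i i≤n → f≈f′ (suc i) (s≤s i≤n)) (λ i i≤n → g≈g′ i (ℕ.m≤n⇒m≤1+n i≤n)))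

    *-cong : ∀ N {f f′ g g′} → f ≈[ N ] f′ → g ≈[ N ] g′ → f * g ≈[ N ] f′ * g′
    *-cong N f≈f′ g≈g′ n n<N = *-cong-≤ n (λ i i≤n → f≈f′ i (ℕ.≤-<-trans i≤n n<N)) (λ i i≤n → g≈g′ i (ℕ.≤-<-trans i≤n n<N))

    *-zeroˡ : ∀ n g → (0# * g) n K.≈ K.0#
    *-zeroˡ zero    g = K.trans (K.+-identityʳ _) (K.zeroˡ _)
    *-zeroˡ (suc n) g = K.trans (K.+-cong (K.zeroˡ _) (*-zeroˡ n g)) (K.+-identityˡ _)

    -- The definition splits off the term with `f 0`; splitting off the one with `g 0` instead is
    -- what commutativity needs.
    *-last : ∀ n f g → (f * g) (suc n) K.≈ (f * (g ∘ suc)) n K.+ f (suc n) K.* g 0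
    *-last zero    f g = K.solve 2 (λ x y → x K.:+ (y K.:+ K.:0) K.:= x K.:+ K.:0 K.:+ y) K.refl (f 0 K.* g 1) (f 1 K.* g 0)
    *-last (suc n) f g = K.trans (K.+-congˡ (*-last n (f ∘ suc) g)) (K.sym (K.+-assoc _ _ _))

    *-comm : ∀ n f g → (f * g) n K.≈ (g * f) n
    *-comm zero    f g = K.+-congʳ (K.*-comm _ _)
    *-comm (suc n) f g = K.begin
      f 0 K.* g (suc n) K.+ ((f ∘ suc) * g) n    K.≈⟨ K.+-cong (K.*-comm _ _) (*-comm n (f ∘ suc) g) ⟩
      g (suc n) K.* f 0 K.+ (g * (f ∘ suc)) n    K.≈⟨ K.+-comm _ _ ⟩
      (g * (f ∘ suc)) n K.+ g (suc n) K.* f 0    K.≈⟨ *-last n g f ⟨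
      (g * f) (suc n)                            K.∎

    *-distribʳ : ∀ n h f g → ((f + g) * h) n K.≈ (f * h) n K.+ (g * h) n
    *-distribʳ zero    h f g = K.solve 3 (λ x y z → (x K.:+ y) K.:* z K.:+ K.:0 K.:= x K.:* z K.:+ K.:0 K.:+ (y K.:* z K.:+ K.:0)) K.refl (f 0) (g 0) (h 0)
    *-distribʳ (suc n) h f g = K.trans (K.+-congˡ (*-distribʳ n h (f ∘ suc) (g ∘ suc)))
      (K.solve 5 (λ x y z u v → (x K.:+ y) K.:* z K.:+ (u K.:+ v) K.:= x K.:* z K.:+ u K.:+ (y K.:* z K.:+ v)) K.refl (f 0) (g 0) (h (suc n)) _ _)

    ·-* : ∀ n a f g → ((a · f) * g) n K.≈ a K.* (f * g) n
    ·-* zero    a f g = K.solve 3 (λ x y z → x K.:* y K.:* z K.:+ K.:0 K.:= x K.:* (y K.:* z K.:+ K.:0)) K.refl a (f 0) (g 0)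
    ·-* (suc n) a f g = K.trans (K.+-congˡ (·-* n a (f ∘ suc) g))
      (K.solve 4 (λ x y z u → x K.:* y K.:* z K.:+ x K.:* u K.:= x K.:* (y K.:* z K.:+ u)) K.refl a (f 0) (g (suc n)) _)

    *-assoc : ∀ n f g h → ((f * g) * h) n K.≈ (f * (g * h)) n
    *-assoc zero    f g h = K.solve 3 (λ x y z → (x K.:* y K.:+ K.:0) K.:* z K.:+ K.:0 K.:= x K.:* (y K.:* z K.:+ K.:0) K.:+ K.:0) K.refl (f 0) (g 0) (h 0)
    *-assoc (suc n) f g h = K.begin
      -- The shifted product `(f * g) ∘ suc` unfolds definitionally to
      -- `f 0 · (g ∘ suc) + (f ∘ suc) * g`.
      (f * g) 0 K.* h (suc n) K.+ ((f 0 · (g ∘ suc) + (f ∘ suc) * g) * h) n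
        K.≈⟨ K.+-congˡ (*-distribʳ n h (f 0 · (g ∘ suc)) ((f ∘ suc) * g)) ⟩
      (f * g) 0 K.* h (suc n) K.+ (((f 0 · (g ∘ suc)) * h) n K.+ (((f ∘ suc) * g) * h) n)
        K.≈⟨ K.+-congˡ (K.+-cong (·-* n (f 0) (g ∘ suc) h) (*-assoc n (f ∘ suc) g h)) ⟩
      (f 0 K.* g 0 K.+ K.0#) K.* h (suc n) K.+ (f 0 K.* ((g ∘ suc) * h) n K.+ ((f ∘ suc) * (g * h)) n)
        K.≈⟨ K.solve 5 (λ x y z u v → (x K.:* y K.:+ K.:0) K.:* z K.:+ (x K.:* u K.:+ v) K.:= x K.:* (y K.:* z K.:+ u) K.:+ v) K.refl (f 0) (g 0) (h (suc n)) _ _ ⟩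
      (f * (g * h)) (suc n) K.∎

    *-identityˡ : ∀ n f → (1# * f) n K.≈ f n
    *-identityˡ zero    f = K.trans (K.+-identityʳ _) (K.*-identityˡ _)
    *-identityˡ (suc n) f = K.trans (K.+-cong (K.*-identityˡ _) (*-zeroˡ n f)) (K.+-identityʳ _)

  -- Power series modulo q^N.
  truncatedRing : ℕ → CommutativeRing c ℓ
  truncatedRing N = record
    { Carrier = Carrier
    ; _≈_ = _≈[ N ]_
    ; _+_ = _+_
    ; _*_ = _*_
    ; -_ = -_
    ; 0# = 0#
    ; 1# = 1#
    ; isCommutativeRing = record
      { isRing = record
        { +-isAbelianGroup = record
          { isGroup = record
            { isMonoid = record
              { isSemigroup = record
                { isMagma = record
                  { isEquivalence = record
                    { refl  = λ _ _ → K.refl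
                    ; sym   = λ f≈g n n<N → K.sym (f≈g n n<N)
                    ; trans = λ f≈g g≈h n n<N → K.trans (f≈g n n<N) (g≈h n n<N)
                    }
                  ; ∙-cong = λ f≈f′ g≈g′ n n<N → K.+-cong (f≈f′ n n<N) (g≈g′ n n<N)
                  }
                ; assoc = λ _ _ _ _ _ → K.+-assoc _ _ _
                }
              ; identity = (λ _ _ _ → K.+-identityˡ _) , (λ _ _ _ → K.+-identityʳ _)
              }
            ; inverse = (λ _ _ _ → K.-‿inverseˡ _) , (λ _ _ _ → K.-‿inverseʳ _)
            ; ⁻¹-cong = λ f≈g n n<N → K.-‿cong (f≈g n n<N)
            }
          ; comm = λ _ _ _ _ → K.+-comm _ _
          }
        ; *-cong = *-cong N
        ; *-assoc = λ f g h n _ → *-assoc n f g h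
        ; *-identity = (λ f n _ → *-identityˡ n f) , (λ f n _ → K.trans (*-comm n f 1#) (*-identityˡ n f))
        ; distrib = (λ f g h n _ → K.trans (*-comm n f (g + h)) (K.trans (*-distribʳ n f g h) (K.+-cong (*-comm n g f) (*-comm n h f))))
                  , (λ h f g n _ → *-distribʳ n h f g)
        }
      ; *-comm = λ f g n _ → *-comm n f g
      }
    }

  q^-* : ∀ m f n → (q^ suc m * f) (suc n) K.≈ (q^ m * f) n
  q^-* m f n = K.trans (K.+-congʳ (K.zeroˡ _)) (K.+-identityˡ _)

  q^-+ : ∀ m n → q^ (m ℕ.+ n) ≈ q^ m * q^ n
  q^-+ zero    n i       = K.sym (*-identityˡ i (q^ n))
  q^-+ (suc m) n zero    = K.sym (K.trans (K.+-identityʳ _) (K.zeroˡ _))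
  q^-+ (suc m) n (suc i) = K.trans (q^-+ m n i) (K.sym (q^-* m (q^ n) i))

  q^≈0 : ∀ {N n} → N ≤ n → q^ n ≈[ N ] 0#
  q^≈0 {N} {n} N≤n i i<N = K.reflexive (≡.cong (λ b → if b then K.1# else K.0#)
    (dec-false (n ℕ.≟ i) λ n≡i → ℕ.<⇒≱ i<N (≡.subst (N ≤_) n≡i N≤n)))

  constant-* : ∀ a b → monomial (a K.* b) 0 ≈ monomial a 0 * monomial b 0
  constant-* a b zero    = K.sym (K.+-identityʳ _)
  constant-* a b (suc n) = K.sym (K.trans (K.+-cong (K.zeroʳ _) (*-zeroˡ n (monomial b 0))) (K.+-identityˡ _))

  module Truncated (N : ℕ) where
    open CommutativeRing (truncatedRing N) public
      using (setoid; reflexive; refl; trans; +-congˡ; -‿cong; *-congˡ; *-congʳ; zeroˡ; *-identityˡ)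
      renaming (*-cong to *-cong′)
    open InitialRingSums (truncatedRing N) public renaming (_^_ to _^′_)
    open IntegerSolver (truncatedRing N) public using (solve; _:=_; :0; :1; _:*_; _:-_)

    -- For a variable exponent this is not definitional: the two powers are
    -- defined over structures with different equalities.
    ^′≡^ : ∀ f k → f ^′ k ≡ f ^ k
    ^′≡^ f zero    = ≡.refl
    ^′≡^ f (suc k) = ≡.cong (f *_) (^′≡^ f k)

  ≈[]-weaken : ∀ {M N f g} → M ≤ N → f ≈[ N ] g → f ≈[ M ] g
  ≈[]-weaken M≤N f≈g n n<M = f≈g n (ℕ.≤-trans n<M M≤N)

  -- The number of terms that `∑∞` adds varies with the coefficient. For coefficient `n` the
  -- comparison is made modulo `q^(n+1)`, where all later terms vanish.
  ∑∞≈sum< : ∀ {N M f} → N ≤ M → (∀ k → f k ≈[ k ] 0#) → ∑∞ f ≈[ N ] Truncated.sum< N M f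
  ∑∞≈sum< {N} {M} {f} N≤M f≈0 n n<N = K.begin
    ∑∞ f n                          K.≡⟨ ≡.cong (λ s → s n) (T.sum<≡sum (suc n) f) ⟨
    T.sum< (suc n) f n              K.≈⟨ T.sum<-truncate (ℕ.≤-trans n<N N≤M) (λ k n<k → ≈[]-weaken n<k (f≈0 k)) n ℕ.≤-refl ⟨
    -- The opaque sums modulo `q^(n+1)` and modulo `q^N` unfold to the same sum of series; only the
    -- equality of the two rings differs.
    T.sum< M f n                    K.≡⟨ ≡.cong (λ s → s n) (≡.trans (T.sum<≡sum M f) (≡.sym (Truncated.sum<≡sum N M f))) ⟩
    Truncated.sum< N M f n          K.∎
    where module T = Truncated (suc n)

  ∏∞≈product< : ∀ {N M f} → N ≤ M → (∀ k → f k ≈[ k ] 1#) → ∏∞ f ≈[ N ] Truncated.product< N M f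
  ∏∞≈product< {N} {M} {f} N≤M f≈1 n n<N = K.begin
    ∏∞ f n                          K.≡⟨ ≡.cong (λ s → s n) (T.product<≡product (suc n) f) ⟨
    T.product< (suc n) f n          K.≈⟨ T.product<-truncate (ℕ.≤-trans n<N N≤M) (λ k n<k → ≈[]-weaken n<k (f≈1 k)) n ℕ.≤-refl ⟨
    T.product< M f n                K.≡⟨ ≡.cong (λ s → s n) (≡.trans (T.product<≡product M f) (≡.sym (Truncated.product<≡product N M f))) ⟩
    Truncated.product< N M f n      K.∎
    where module T = Truncated (suc n)

  1-*q^≈1 : ∀ a {k m} → k ≤ m → 1# - a * q^ m ≈[ k ] 1#
  1-*q^≈1 a {k} {m} k≤m = T.trans (T.+-congˡ {1#} (T.-‿cong (T.*-congˡ {a} (q^≈0 k≤m))))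
    (T.solve 1 (λ a → T.:1 T.:- a T.:* T.:0 T.:= T.:1) T.refl a)
    where module T = Truncated k

  pochhammer≈product< : ∀ {N} a d .{{_ : ℕ.NonZero d}} →
                        ⟨ a ⨾q^ d ⟩∞ ≈[ N ] Truncated.product< N N (λ k → 1# - a * q^ (d ℕ.* k))
  pochhammer≈product< a d = ∏∞≈product< ℕ.≤-refl λ k → 1-*q^≈1 a (ℕ.m≤n*m k d)

  power≈0 : ∀ {f} → f 0 K.≈ K.0# → ∀ k → f ^ k ≈[ k ] 0#
  power≈0 f₀≈0 (suc k) zero    _         = K.trans (K.+-identityʳ _) (K.trans (K.*-congʳ f₀≈0) (K.zeroˡ _))
  power≈0 {f} f₀≈0 (suc k) (suc n) (s≤s n<k) = K.begin
    f 0 K.* (f ^ k) (suc n) K.+ ((f ∘ suc) * f ^ k) n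
      K.≈⟨ K.+-cong (K.trans (K.*-congʳ f₀≈0) (K.zeroˡ _)) (*-cong k {f = f ∘ suc} {g = f ^ k} (λ _ _ → K.refl) (power≈0 f₀≈0 k) n n<k) ⟩
    K.0# K.+ ((f ∘ suc) * 0#) n       K.≈⟨ K.+-identityˡ _ ⟩
    ((f ∘ suc) * 0#) n                K.≈⟨ *-comm n (f ∘ suc) 0# ⟩
    (0# * (f ∘ suc)) n                K.≈⟨ *-zeroˡ n (f ∘ suc) ⟩
    K.0#                              K.∎

  *-reciprocal : ∀ {f} → f 0 K.≈ K.1# → ∀ N → f * reciprocal f ≈[ N ] 1#
  *-reciprocal {f} f₀≈1 N = T.begin
    f * reciprocal f                                  T.≈⟨ T.*-congˡ {f} (∑∞≈sum< ℕ.≤-refl (power≈0 1-f₀≈0)) ⟩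
    f * T.sum< N ((1# - f) ^_)                        T.≈⟨ T.*-congˡ {f} (T.sum<-cong N λ k _ → T.reflexive (≡.sym (T.^′≡^ (1# - f) k))) ⟩
    -- Writing `f` as `1 - (1 - f)` brings in the finite geometric sum; its error `(1 - f)^N` is
    -- divisible by `q^N`.
    f * T.sum< N ((1# - f) T.^′_)                     T.≈⟨ T.*-congʳ {T.sum< N ((1# - f) T.^′_)} (T.solve 1 (λ f → T.:1 T.:- (T.:1 T.:- f) T.:= f) T.refl f) ⟨
    (1# - (1# - f)) * T.sum< N ((1# - f) T.^′_)       T.≈⟨ T.geometric (1# - f) N ⟩
    1# - (1# - f) T.^′ N                              T.≡⟨ ≡.cong (λ g → 1# - g) (T.^′≡^ (1# - f) N) ⟩
    1# - (1# - f) ^ N                                 T.≈⟨ T.+-congˡ {1#} (T.-‿cong (power≈0 1-f₀≈0 N)) ⟩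
    1# - 0#                                           T.≈⟨ T.solve 0 (T.:1 T.:- T.:0 T.:= T.:1) T.refl ⟩
    1#                                                T.∎
    where
    module T where
      open Truncated N public
      open SetoidReasoning setoid public
    1-f₀≈0 : (1# - f) 0 K.≈ K.0#
    1-f₀≈0 = K.trans (K.+-congˡ (K.-‿cong f₀≈1)) (K.-‿inverseʳ K.1#)

  -- Arithmetic modulo `q` reads off the constant term, which must be 1 for `reciprocal` to give an
  -- inverse.
  pochhammer₀≈1 : ∀ a n → ⟨ a * q^ suc n ⨾q^ 1 ⟩∞ ≈[ 1 ] 1#
  pochhammer₀≈1 a n = T.begin
    ⟨ a * q^ suc n ⨾q^ 1 ⟩∞                             T.≈⟨ pochhammer≈product< (a * q^ suc n) 1 ⟩
    T.product< 1 (λ k → 1# - a * q^ suc n * q^ (1 ℕ.* k)) T.≈⟨ T.product<-1 _ ⟩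
    1# - a * q^ suc n * q^ 0                            T.≈⟨ T.+-congˡ (T.-‿cong (T.*-congʳ {q^ 0} (T.*-congˡ {a} (q^≈0 (s≤s z≤n))))) ⟩
    1# - a * 0# * q^ 0                                  T.≈⟨ T.solve 2 (λ a q → T.:1 T.:- a T.:* T.:0 T.:* q T.:= T.:1) T.refl a (q^ 0) ⟩
    1#                                                  T.∎
    where
    module T where
      open Truncated 1 public
      open SetoidReasoning setoid public

  module CrankSum (a b : Carrier) (N : ℕ) where

    private
      module T where
        open Truncated N public
        open SetoidReasoning setoid public

      poch : Carrier → ℕ → Carrier
      poch c d = T.product< N (λ k → 1# - c * q^ (d ℕ.* k))

    denominator : ℕ → Carrier
    denominator n = ⟨ a * q^ n ⨾q^ 1 ⟩∞ * ⟨ b * q^ n ⨾q^ 1 ⟩∞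

    denominator-inverse : ∀ n → poch (a * q^ suc n) 1 * poch (b * q^ suc n) 1 * reciprocal (denominator (suc n)) ≈[ N ] 1#
    denominator-inverse n = T.begin
      poch (a * q^ suc n) 1 * poch (b * q^ suc n) 1 * reciprocal (denominator (suc n))
        T.≈⟨ T.*-congʳ (T.*-cong′ (pochhammer≈product< (a * q^ suc n) 1) (pochhammer≈product< (b * q^ suc n) 1)) ⟨
      denominator (suc n) * reciprocal (denominator (suc n))
        T.≈⟨ *-reciprocal d₀≈1 N ⟩
      1# T.∎
      where
      module T₁ = Truncated 1
      d₀≈1 : denominator (suc n) 0 K.≈ K.1#
      d₀≈1 = T₁.trans (T₁.*-cong′ (pochhammer₀≈1 a n) (pochhammer₀≈1 b n)) (T₁.*-identityˡ 1#) 0 (s≤s z≤n)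

    crankSum≈ : (∑∞ λ n → (q^ suc n * ⟨ q^ (2 ℕ.* suc n ℕ.+ 2) ⨾q^ 2 ⟩∞) ÷ denominator (suc n))
                ≈[ N ] T.sum< N (λ n → q^ suc n * poch (q^ (2 ℕ.* suc n ℕ.+ 2)) 2 * reciprocal (denominator (suc n)))
    crankSum≈ = T.trans (∑∞≈sum< ℕ.≤-refl term≈0)
      (T.sum<-cong N λ n _ → T.*-congʳ (T.*-congˡ {q^ suc n} (pochhammer≈product< (q^ (2 ℕ.* suc n ℕ.+ 2)) 2)))
      where
      term≈0 : ∀ n → (q^ suc n * ⟨ q^ (2 ℕ.* suc n ℕ.+ 2) ⨾q^ 2 ⟩∞) ÷ denominator (suc n) ≈[ n ] 0#
      term≈0 n = Tₙ.trans (Tₙ.*-congʳ {reciprocal (denominator (suc n))}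
        (Tₙ.trans (Tₙ.*-congʳ {t} (q^≈0 (ℕ.n≤1+n n))) (Tₙ.zeroˡ t))) (Tₙ.zeroˡ (reciprocal (denominator (suc n))))
        where
        module Tₙ = Truncated n
        t = ⟨ q^ (2 ℕ.* suc n ℕ.+ 2) ⨾q^ 2 ⟩∞

    prefactor≈ : ∀ c → c * ⟨ a ⨾q^ 1 ⟩∞ * ⟨ b ⨾q^ 1 ⟩∞ * ⟨ q^ 1 ⨾q^ 1 ⟩∞ ≈[ N ] c * poch a 1 * poch b 1 * poch (q^ 1) 1
    prefactor≈ c = T.*-cong′ (T.*-cong′ (T.*-congˡ {c} (pochhammer≈product< a 1)) (pochhammer≈product< b 1)) (pochhammer≈product< (q^ 1) 1)

-- The double series of the theorem over ℤ[z, z⁻¹].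

open import Defs
open LaurentPolynomials using (laurentRing)
open TruncatedPowerSeries laurentRing

z^-+ : ∀ i j → z^ (i ℤ.+ j) ≈ z^ i * z^ j
z^-+ i j = constant-* ((i , ℤ.1ℤ) ∷ []) ((j , ℤ.1ℤ) ∷ [])

-- At `n = 2∣m∣ + k` the square of `n` contains `2m²` as a summand, so that `∸` is exact; the rest
-- is even because `k² + k` is twice a triangular number.
qExponent-2∣m∣+ : ∀ k m → qExponent (2 ℕ.* ∣ m ∣ ℕ.+ k) m ≡ tri (suc k) ℕ.+ ∣ m ∣ ℕ.* suc (∣ m ∣ ℕ.+ 2 ℕ.* k)
qExponent-2∣m∣+ k m = begin
  (n ℕ.* n ∸ 2 ℕ.* (j ℕ.* j) ℕ.+ n) / 2                        ≡⟨ ≡.cong (λ x → (x ∸ 2 ℕ.* (j ℕ.* j) ℕ.+ n) / 2) (square j k) ⟩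
  (x ℕ.+ 2 ℕ.* (j ℕ.* j) ∸ 2 ℕ.* (j ℕ.* j) ℕ.+ n) / 2          ≡⟨ ≡.cong (λ x → (x ℕ.+ n) / 2) (ℕ.m+n∸n≡m x (2 ℕ.* (j ℕ.* j))) ⟩
  (x ℕ.+ n) / 2                                                ≡⟨ ≡.cong (_/ 2) (rearrange j k) ⟩
  (k ℕ.* k ℕ.+ k ℕ.+ j ℕ.* suc (j ℕ.+ 2 ℕ.* k) ℕ.* 2) / 2      ≡⟨ ≡.cong (λ x → (x ℕ.+ j ℕ.* suc (j ℕ.+ 2 ℕ.* k) ℕ.* 2) / 2) (2*tri-suc k) ⟨
  (tri (suc k) ℕ.* 2 ℕ.+ j ℕ.* suc (j ℕ.+ 2 ℕ.* k) ℕ.* 2) / 2  ≡⟨ ≡.cong (_/ 2) (ℕ.*-distribʳ-+ 2 (tri (suc k)) _) ⟨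
  (tri (suc k) ℕ.+ j ℕ.* suc (j ℕ.+ 2 ℕ.* k)) ℕ.* 2 / 2        ≡⟨ m*n/n≡m _ 2 ⟩
  tri (suc k) ℕ.+ j ℕ.* suc (j ℕ.+ 2 ℕ.* k)                    ∎
  where
  open ≡-Reasoning
  j = ∣ m ∣
  n = 2 ℕ.* j ℕ.+ k
  x = 2 ℕ.* (j ℕ.* j) ℕ.+ 4 ℕ.* (j ℕ.* k) ℕ.+ k ℕ.* k
  square : ∀ j k → (2 ℕ.* j ℕ.+ k) ℕ.* (2 ℕ.* j ℕ.+ k)
                 ≡ 2 ℕ.* (j ℕ.* j) ℕ.+ 4 ℕ.* (j ℕ.* k) ℕ.+ k ℕ.* k ℕ.+ 2 ℕ.* (j ℕ.* j)
  square = solve-∀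
  rearrange : ∀ j k → 2 ℕ.* (j ℕ.* j) ℕ.+ 4 ℕ.* (j ℕ.* k) ℕ.+ k ℕ.* k ℕ.+ (2 ℕ.* j ℕ.+ k)
                    ≡ k ℕ.* k ℕ.+ k ℕ.+ j ℕ.* suc (j ℕ.+ 2 ℕ.* k) ℕ.* 2
  rearrange = solve-∀

module TruncatedSummands (N : ℕ) where

  module R where
    open CommutativeRing (truncatedRing N) public
    open InitialRingSums (truncatedRing N) public
    open TruncatedQSeries (truncatedRing N) q^_ (λ _ _ _ → ≡.refl) (λ m n i _ → q^-+ m n i) N q^≈0 public
    open SetoidReasoning setoid public

  z₀ : z^ (+ 0) R.≈ 1#
  z₀ _ _ _ = ≡.refl
  z₊ : ∀ i j → z^ (i ℤ.+ j) R.≈ z^ i * z^ j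
  z₊ i j n _ = z^-+ i j n

  hecke : ℕ → ℕ → Carrier
  hecke = R.hecke z^_ z₀ z₊

  sign≈ : ∀ k m → (- 1#) ^ ∣ m ℤ.+ + (2 ℕ.* ∣ m ∣ ℕ.+ k) ∣ R.≈ R.sgn k * R.sgn ∣ m ∣
  sign≈ k m = R.begin
    (- 1#) ^ ∣ m ℤ.+ + (2 ℕ.* ∣ m ∣ ℕ.+ k) ∣     R.≡⟨ Truncated.^′≡^ N (- 1#) ∣ m ℤ.+ + (2 ℕ.* ∣ m ∣ ℕ.+ k) ∣ ⟨
    (- 1#) R.^ ∣ m ℤ.+ + (2 ℕ.* ∣ m ∣ ℕ.+ k) ∣   R.≈⟨ R.-1^≈sgn ∣ m ℤ.+ + (2 ℕ.* ∣ m ∣ ℕ.+ k) ∣ ⟩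
    R.sgn ∣ m ℤ.+ + (2 ℕ.* ∣ m ∣ ℕ.+ k) ∣        R.≈⟨ parity m ⟩
    R.sgn (∣ m ∣ ℕ.+ k)                          R.≈⟨ R.sgn-+ ∣ m ∣ k ⟩
    R.sgn ∣ m ∣ * R.sgn k                        R.≈⟨ R.*-comm (R.sgn ∣ m ∣) (R.sgn k) ⟩
    R.sgn k * R.sgn ∣ m ∣                        R.∎
    where
    parity : ∀ m → R.sgn ∣ m ℤ.+ + (2 ℕ.* ∣ m ∣ ℕ.+ k) ∣ R.≈ R.sgn (∣ m ∣ ℕ.+ k)
    parity (+ j) = R.begin
      R.sgn (j ℕ.+ (2 ℕ.* j ℕ.+ k))   R.≡⟨ ≡.cong R.sgn (swap j k) ⟩
      R.sgn (2 ℕ.* j ℕ.+ (j ℕ.+ k))   R.≈⟨ R.sgn-2*+ j (j ℕ.+ k) ⟩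
      R.sgn (j ℕ.+ k)                 R.∎
      where
      swap : ∀ j k → j ℕ.+ (2 ℕ.* j ℕ.+ k) ≡ 2 ℕ.* j ℕ.+ (j ℕ.+ k)
      swap = solve-∀
    -- For negative `m` the sum `m + 2∣m∣ + k` equals `∣m∣ + k` itself; for the other sign it
    -- exceeds this by the even number `2∣m∣`.
    parity -[1+ j ] = R.reflexive (≡.cong R.sgn (≡.trans
      (≡.cong (λ n → ∣ n ℤ.⊖ suc j ∣) (double (suc j) k))
      (≡.cong ∣_∣ (≡.trans (ℤ.⊖-≥ {suc j ℕ.+ (suc j ℕ.+ k)} (ℕ.m≤m+n (suc j) _)) (≡.cong +_ (ℕ.m+n∸m≡n (suc j) _))))))
      where
      double : ∀ j k → 2 ℕ.* j ℕ.+ k ≡ j ℕ.+ (j ℕ.+ k)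
      double = solve-∀

  summand-2∣m∣+ : ∀ k m → summand (2 ℕ.* ∣ m ∣ ℕ.+ k) m R.≈ hecke k ∣ m ∣
  summand-2∣m∣+ k m = R.begin
    summand n m                                             R.≡⟨ ≡.cong summand′ n-2∣m∣≡k ⟩
    summand′ (+ k)                                          R.≡⟨ ≡.cong₂ (λ i e → s * (1# - z^ (+ i)) * (1# - z^ (+ k)) * z^ (ℤ.- + k) * q^ e)
                                                                  (ℕ.+-comm k 1) (qExponent-2∣m∣+ k m) ⟩
    s * (1# - z^ (+ suc k)) * (1# - z^ (+ k)) * z^ (ℤ.- + k) * Q
      R.≈⟨ R.factored-hecke z^_ z₀ z₊ k ∣ m ∣ s (sign≈ k m) ⟩
    hecke k ∣ m ∣                                           R.∎
    where
    n = 2 ℕ.* ∣ m ∣ ℕ.+ k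
    s = (- 1#) ^ ∣ m ℤ.+ + n ∣
    Q = q^ (tri (suc k) ℕ.+ ∣ m ∣ ℕ.* suc (∣ m ∣ ℕ.+ 2 ℕ.* k))
    -- The integer `n - 2∣m∣` is abstracted so that all its occurrences become `+ k` in one
    -- rewriting.
    summand′ : ℤ → Carrier
    summand′ l = s * (1# - z^ (l ℤ.+ + 1)) * (1# - z^ l) * z^ (ℤ.- l) * q^ (qExponent n m)
    n-2∣m∣≡k : + n ℤ.- + (2 ℕ.* ∣ m ∣) ≡ + k
    n-2∣m∣≡k = ≡.trans (ℤ.m-n≡m⊖n n (2 ℕ.* ∣ m ∣)) (≡.trans (ℤ.⊖-≥ (ℕ.m≤m+n (2 ℕ.* ∣ m ∣) k)) (≡.cong +_ (ℕ.m+n∸m≡n (2 ℕ.* ∣ m ∣) k)))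

  ∑±summand : ∀ n → ∑± (n / 2) (summand n) R.≈ R.sum< (suc (n / 2)) (λ j → R.twiceUnless0 j (hecke (n ∸ 2 ℕ.* j) j))
  ∑±summand n = R.begin
    ∑± h (summand n)                                                       R.≡⟨ R.sum<≡sum (suc (2 ℕ.* h)) (λ i → summand n (+ i ℤ.- + h)) ⟨
    R.sum< (suc (2 ℕ.* h)) (λ i → summand n (+ i ℤ.- + h))                 R.≈⟨ R.sum<-symmetric h (summand n) ⟩
    summand n (+ 0) + R.sum< h (λ j → summand n (+ suc j) + summand n -[1+ j ])
      R.≈⟨ R.+-cong {summand n (+ 0)} {t 0} (summand≈ (+ 0) z≤n)
             (R.sum<-cong h λ j j<h → R.+-cong {summand n (+ suc j)} {t (suc j)} {summand n -[1+ j ]} {t (suc j)}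
               (summand≈ (+ suc j) j<h) (summand≈ -[1+ j ] j<h)) ⟩
    t 0 + R.sum< h (λ j → t (suc j) + t (suc j))                           R.≡⟨ R.sum<-head h (λ j → R.twiceUnless0 j (t j)) ⟨
    R.sum< (suc h) (λ j → R.twiceUnless0 j (t j))                          R.∎
    where
    h = n / 2
    t : ℕ → Carrier
    t j = hecke (n ∸ 2 ℕ.* j) j
    summand≈ : ∀ m → ∣ m ∣ ≤ h → summand n m R.≈ t ∣ m ∣
    summand≈ m ∣m∣≤h = ≡.subst (λ n′ → summand n′ m R.≈ t ∣ m ∣)
      (ℕ.m+[n∸m]≡n (≤n/2⇒2*≤n ∣m∣≤h)) (summand-2∣m∣+ (n ∸ 2 ℕ.* ∣ m ∣) m)

  -- Read at `N = n`, this is the proviso of `∑∞`: the `n`-th inner sum is divisible by `q^n`.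
  ∑±summand-≥N : ∀ n → N ≤ n → ∑± (n / 2) (summand n) R.≈ 0#
  ∑±summand-≥N n N≤n = R.begin
    ∑± (n / 2) (summand n)                                                        R.≈⟨ ∑±summand n ⟩
    R.sum< (suc (n / 2)) (λ j → R.twiceUnless0 j (hecke (n ∸ 2 ℕ.* j) j))         R.≈⟨ R.hecke-half-sum-≥N z^_ z₀ z₊ n N≤n ⟩
    0#                                                                            R.∎

module _ (N : ℕ) where

  open TruncatedSummands N

  lhs≈rhs : (1# + z^ (+ 1)) * ⟨ z^ (+ 1) ⨾q^ 1 ⟩∞ * ⟨ z^ -[1+ 0 ] ⨾q^ 1 ⟩∞ * ⟨ q^ 1 ⨾q^ 1 ⟩∞ * S̄
            R.≈ ∑∞ (λ n → ∑± (n / 2) (summand n))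
  lhs≈rhs = R.begin
    (1# + z^ (+ 1)) * ⟨ z^ (+ 1) ⨾q^ 1 ⟩∞ * ⟨ z^ -[1+ 0 ] ⨾q^ 1 ⟩∞ * ⟨ q^ 1 ⨾q^ 1 ⟩∞ * S̄
      R.≈⟨ R.*-cong {p} {p′} {S̄} {s} (prefactor≈ (1# + z^ (+ 1))) crankSum≈ ⟩
    p′ * s
      R.≈⟨ R.spt-expansion z^_ z₀ z₊ (λ n → reciprocal (denominator n)) denominator-inverse ⟩
    R.sum< (suc N) (λ k → R.sum< (suc N) λ j → R.twiceUnless0 j (hecke k j))
      R.≈⟨ R.hecke-half-sum z^_ z₀ z₊ ⟨
    R.sum< (suc N) (λ n → R.sum< (suc (n / 2)) λ j → R.twiceUnless0 j (hecke (n ∸ 2 ℕ.* j) j))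
      R.≈⟨ R.sum<-cong (suc N) (λ n _ → ∑±summand n) ⟨
    R.sum< (suc N) (λ n → ∑± (n / 2) (summand n))
      R.≈⟨ ∑∞≈sum< {N} {suc N} {λ n → ∑± (n / 2) (summand n)} (ℕ.n≤1+n N) ∑±summand≈0 ⟨
    ∑∞ (λ n → ∑± (n / 2) (summand n)) R.∎
    where
    open CrankSum (z^ (+ 1)) (z^ -[1+ 0 ]) N
    p = (1# + z^ (+ 1)) * ⟨ z^ (+ 1) ⨾q^ 1 ⟩∞ * ⟨ z^ -[1+ 0 ] ⨾q^ 1 ⟩∞ * ⟨ q^ 1 ⨾q^ 1 ⟩∞
    p′ = (1# + z^ (+ 1)) * R.poch (z^ (+ 1)) 1 N * R.poch (z^ -[1+ 0 ]) 1 N * R.poch (q^ 1) 1 N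
    s = R.sum< N (λ n → q^ suc n * R.poch (q^ (2 ℕ.* suc n ℕ.+ 2)) 2 N * reciprocal (denominator (suc n)))
    ∑±summand≈0 : ∀ n → ∑± (n / 2) (summand n) ≈[ n ] 0#
    -- The modulus is `q^n` here, not the ambient `q^N`.
    ∑±summand≈0 n = TruncatedSummands.∑±summand-≥N n n ℕ.≤-refl

theorem6p1 : (1# + z^ (+ 1)) * ⟨ z^ (+ 1) ⨾q^ 1 ⟩∞ * ⟨ z^ -[1+ 0 ] ⨾q^ 1 ⟩∞ * ⟨ q^ 1 ⨾q^ 1 ⟩∞ * S̄
    ≈ ∑∞ λ n → ∑± (n / 2) λ m → summand n m
-- Working modulo `q^(n+1)` is just enough to see the coefficient of `q^n`.
theorem6p1 n = lhs≈rhs (suc n) n ℕ.≤-refl
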